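{- Let $G=(V,E)$ be a connected undirected graph that is not a tree, with $n=|V|$ and $m=|E|$. Then the expected number of random variables drawn by the sink-popping algorithm on $G$ (including the initial draws) to sample a sink-free orientation is at most $m+n(n-1)$.
   Context: Sink-popping: orient each edge independently and uniformly at random (one random variable per edge); while some vertex is a sink (has no outgoing edge), re-orient independently and uniformly at random every edge incident to some sink; output the final orientation, which is a uniformly random sink-free orientation of $G$. -}

module Defs where

open import Data.Nat as ℕ using (ℕ; zero; suc)
open import Data.Bool using (Bool; true; false; if_then_else_; not; _∨_)
open import Data.Fin using (Fin; toℕ; inject₁; fromℕ)
open import Data.Fin.Base using () renaming (zero to fzero; suc to fsuc)
open import Data.Fin.Properties using (_≟_)
open import Data.Vec using (Vec; []; _∷_; lookup; tabulate; replicate)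
open import Data.List using (List; allFin)
open import Data.Bool.ListAction using (any)
open import Data.Product using (_×_; _,_; Σ; ∃; proj₁; proj₂)
open import Data.Sum using (_⊎_)
open import Data.Integer using (+_)
open import Data.Rational using (ℚ; _+_; _*_; ½; 0ℚ; _/_)
open import Relation.Binary.PropositionalEquality using (_≡_)
open import Relation.Nullary using (¬_; does)
open import Function using (_∘_)
open import Function.Definitions using (Injective)

-- Graphs.  A (finite, undirected) graph on vertex set  Fin n  with
-- m edges is given by an edge map  E : Fin m → Fin n × Fin n ;
-- edge i joins  proj₁ (E i)  and  proj₂ (E i).

-- Simple graph: every edge (u , v) is stored with u < v (no loops,
-- canonical form), and distinct edge indices give distinct edges.
SimpleGraph : (n m : ℕ) → (Fin m → Fin n × Fin n) → Set
SimpleGraph n m E =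
  ((i : Fin m) → toℕ (proj₁ (E i)) ℕ.< toℕ (proj₂ (E i))) × Injective _≡_ _≡_ E

Adj : {n m : ℕ} → (Fin m → Fin n × Fin n) → Fin n → Fin n → Set
Adj {n} {m} E u v = Σ (Fin m) λ i → (E i ≡ (u , v)) ⊎ (E i ≡ (v , u))

data Walk {n m : ℕ} (E : Fin m → Fin n × Fin n) : Fin n → Fin n → Set where
  here : ∀ {u} → Walk E u u
  step : ∀ {u w v} → Adj E u w → Walk E w v → Walk E u v

Connected : {n m : ℕ} → (Fin m → Fin n × Fin n) → Set
Connected E = ∀ u v → Walk E u v

HasCycle : {n m : ℕ} → (Fin m → Fin n × Fin n) → Set
HasCycle {n} E =
  Σ ℕ λ k → Σ (Fin (3 ℕ.+ k) → Fin n) λ c →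
    Injective _≡_ _≡_ c
    × ((i : Fin (2 ℕ.+ k)) → Adj E (c (inject₁ i)) (c (fsuc i)))
    × Adj E (c (fromℕ (2 ℕ.+ k))) (c fzero)

Acyclic : {n m : ℕ} → (Fin m → Fin n × Fin n) → Set
Acyclic E = ¬ HasCycle E

IsTree : {n m : ℕ} → (Fin m → Fin n × Fin n) → Set
IsTree E = Connected E × Acyclic E

Orientation : ℕ → Set
Orientation m = Vec Bool m

tailOf : {n : ℕ} → Fin n × Fin n → Bool → Fin n
tailOf (u , v) true  = u
tailOf (u , v) false = v

hasOut : {n m : ℕ} → (Fin m → Fin n × Fin n) → Orientation m → Fin n → Bool
hasOut {m = m} E σ v = any (λ i → does (tailOf (E i) (lookup σ i) ≟ v)) (allFin m)

isSink : {n m : ℕ} → (Fin m → Fin n × Fin n) → Orientation m → Fin n → Bool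
isSink E σ v = not (hasOut E σ v)

hasSink : {n m : ℕ} → (Fin m → Fin n × Fin n) → Orientation m → Bool
hasSink {n} E σ = any (isSink E σ) (allFin n)

resampleMask : {n m : ℕ} → (Fin m → Fin n × Fin n) → Orientation m → Vec Bool m
resampleMask E σ = tabulate λ i → isSink E σ (proj₁ (E i)) ∨ isSink E σ (proj₂ (E i))

count : {k : ℕ} → Vec Bool k → ℕ
count []           = 0
count (true ∷ bs)  = suc (count bs)
count (false ∷ bs) = count bs

ℕ→ℚ : ℕ → ℚ
ℕ→ℚ k = + k / 1

resampleAvg : {k : ℕ} → Vec Bool k → Vec Bool k → (Vec Bool k → ℚ) → ℚ
resampleAvg []           []      f = f []
resampleAvg (true ∷ ms)  (_ ∷ σ) f =
  ½ * (resampleAvg ms σ (f ∘ (true ∷_)) + resampleAvg ms σ (f ∘ (false ∷_)))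
resampleAvg (false ∷ ms) (b ∷ σ) f = resampleAvg ms σ (f ∘ (b ∷_))

uniformAvg : (k : ℕ) → (Vec Bool k → ℚ) → ℚ
uniformAvg k f = resampleAvg (replicate k true) (replicate k false) f

expectedFurtherDraws : {n m : ℕ} → (Fin m → Fin n × Fin n) → ℕ → Orientation m → ℚ
expectedFurtherDraws E zero    σ = 0ℚ
expectedFurtherDraws E (suc r) σ =
  if hasSink E σ
  then ℕ→ℚ (count (resampleMask E σ))
         + resampleAvg (resampleMask E σ) σ (expectedFurtherDraws E r)
  else 0ℚ

-- Expected number of variables drawn (initial m draws included) by the
-- sink-popping algorithm run for at most r resampling rounds,
-- i.e.  E[min(T , T_r)]  where T is the total number of draws.
-- These values increase with r and converge (monotone convergence) to
-- the expected number of draws of the untruncated algorithm, so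
-- "E[T] ≤ B" is equivalent to "∀ r, expectedDrawsUpTo E r ≤ B".
expectedDrawsUpTo : {n m : ℕ} → (Fin m → Fin n × Fin n) → ℕ → ℚ
expectedDrawsUpTo {m = m} E r = ℕ→ℚ m + uniformAvg m (expectedFurtherDraws E r)

{-# OPTIONS --safe #-}
-- For a set U of vertices let Q(U) be the probability that all sinks of a uniform orientation lie in U, and R(U, v)
-- the probability that v is a sink and all other sinks lie in U.
--
-- 1. Given that the sinks are exactly S, resampling the edges at S yields a uniform orientation conditioned on having no
--    sink outside the closed neighbourhood of S.  This turns the expected number of times v is popped into a recursion
--    over sets U, which Q and R satisfy as well; comparing them bounds this expectation by R(∅, v) / Q(∅).
-- 2. It remains to show ∑ deg(v) R(∅, v) ≤ n (n - 1) Q(∅).  Peel leaves off the graph.  Removing a leaf u attached to v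
--    costs R(u) + R(v), where R(u) ≤ Q + R(v) by reversing uv.  In the remaining core every degree is at least 2, and for
--    each edge e at v, reversing e and then repairing sinks along a path of core vertices shows that R(v) is at most
--    (size of the core - 1) times the probability that e is the only edge leaving v and no sink remains.  These
--    events are disjoint for different e.
module Submission where

open import Defs

-- The sets U are forced by the process itself. After the sinks S are popped the orientation is no
-- longer uniform but conditioned on having its sinks in the closed neighbourhood of S, so a
-- recursion for the number of pops closes only if it treats all these conditioned laws at once. The
-- quantity R(∅, v) / Q(∅), the probability that v is the only sink against that of no sink, is the
-- usual expected number of resamplings in partial rejection sampling. Only the inequality is shown,
-- by induction on the number of rounds, with a bound that does not depend on that number; hence no
-- limit is taken.
--
-- Dividing by Q(∅) presupposes that sink-free orientations exist. This is extracted from the second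
-- half, whose estimates are proved for every U and give Q(U ∪ {v}) ≤ n Q(U).
--
-- The cycle guarantees that peeling stops at a core with at least two inner edges at each vertex;
-- in a tree it would run down to a single vertex. In such a core a repair path can always leave a
-- vertex by an edge other than the one it came by. Each of its steps costs one copy of the target
-- event and uses up a new vertex, whence the factor.

module SinkPopping where

  open import Data.Nat using (ℕ)
  open import Data.Fin using (Fin)
  open import Data.Product using (_×_)
  open import Data.Rational using (_≤_)
  open import Relation.Nullary using (¬_)
  open import Data.Bool using (Bool; true; false; if_then_else_; not; _∨_)
  import Data.Bool.Properties as Bool
  open import Data.Bool.ListAction using (any)
  open import Data.Fin using (zero; suc; toℕ; inject₁; fromℕ)
  import Data.Fin.Properties as Fin
  open import Data.Fin.Relation.Unary.Top using (view; ‵fromℕ; ‵inject₁)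
  open import Data.Fin.Subset using (Subset; _∈_; _∉_; _⊆_; _∪_; _-_; ⁅_⁆; ⊥; ⊤; Nonempty; ∣_∣)
  open import Data.Fin.Subset.Properties hiding (p⊆q⇒∣p∣<∣q∣)
  import Data.Integer as ℤ
  import Data.Integer.Properties as ℤ
  open import Data.List using (List; []; _∷_; allFin; foldr)
  open import Data.List.Membership.Propositional using (lose) renaming (_∈_ to _∈ₗ_)
  open import Data.List.Membership.Propositional.Properties using (∈-allFin)
  open import Data.List.Relation.Unary.Any using (here; there; satisfied)
  import Data.List.Relation.Unary.Any.Properties as Any
  open import Data.Nat as ℕ using (zero; suc)
  import Data.Nat.Properties as ℕ
  open import Data.Product using (_,_; ∃; proj₁; proj₂)
  open import Data.Product.Properties using (≡-dec)
  open import Data.Rational using (ℚ; _+_; _*_; -_; _<_; 0ℚ; 1ℚ; ½; 1/_; nonNegative; positive; toℚᵘ)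
  open import Data.Rational.Properties hiding (_≟_)
  open import Data.Rational.Solver using (module +-*-Solver)
  import Data.Rational.Unnormalised as ℚᵘ
  import Data.Rational.Unnormalised.Properties as ℚᵘ
  open import Data.Sum using (_⊎_; inj₁; inj₂; [_,_]′)
  open import Data.Vec using (Vec; []; _∷_; lookup; replicate; tabulate; updateAt)
  open import Data.Vec.Properties as Vec
    using (lookup∘tabulate; []=⇒lookup; lookup⇒[]=; tabulate-cong; lookup∘updateAt; lookup∘updateAt′)
  open import Function using (_∘_; Equivalence)
  open import Relation.Nullary using (Dec; yes; no; does; contradiction; ¬?)
  open import Relation.Nullary.Decidable using (_×-dec_; _⊎-dec_; _→-dec_; dec-true; decidable-stable)
  open import Relation.Binary.PropositionalEquality
  open +-*-Solver using (solve; _:+_; _:*_; _:=_)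

  -- Rational inequalities and indicators of decidable events.

  private variable
    P P′ P″ X : Set
    k : ℕ

  *-monoʳ : ∀ {p q r} → 0ℚ ≤ r → p ≤ q → r * p ≤ r * q
  *-monoʳ {r = r} 0≤r = *-monoˡ-≤-nonNeg r {{nonNegative 0≤r}}

  *-monoˡ : ∀ {p q r} → 0ℚ ≤ r → p ≤ q → p * r ≤ q * r
  *-monoˡ {r = r} 0≤r = *-monoʳ-≤-nonNeg r {{nonNegative 0≤r}}

  0≤1 : 0ℚ ≤ 1ℚ
  0≤1 = <⇒≤ (positive⁻¹ 1ℚ)

  0≤½ : 0ℚ ≤ ½
  0≤½ = <⇒≤ (positive⁻¹ ½)

  0≤* : ∀ {p q} → 0ℚ ≤ p → 0ℚ ≤ q → 0ℚ ≤ p * q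
  0≤* {p} 0≤p 0≤q = subst (_≤ p * _) (*-zeroʳ p) (*-monoʳ 0≤p 0≤q)

  0≤+ : ∀ {p q} → 0ℚ ≤ p → 0ℚ ≤ q → 0ℚ ≤ p + q
  0≤+ = +-mono-≤

  p≤p+q : ∀ {p q} → 0ℚ ≤ q → p ≤ p + q
  p≤p+q {p} 0≤q = subst (_≤ p + _) (+-identityʳ p) (+-monoʳ-≤ p 0≤q)

  p≤q+p : ∀ {p q} → 0ℚ ≤ q → p ≤ q + p
  p≤q+p {p} {q} 0≤q = subst (_≤ q + p) (+-identityˡ p) (+-monoˡ-≤ p 0≤q)

  ½-double : ∀ p → ½ * (p + p) ≡ p
  ½-double p = trans (solve 2 (λ h p → h :* (p :+ p) := (h :+ h) :* p) refl ½ p) (*-identityˡ p)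

  ind : Dec P → ℚ
  ind d = if does d then 1ℚ else 0ℚ

  ind-yes : (d : Dec P) → P → ind d ≡ 1ℚ
  ind-yes (yes _) _ = refl
  ind-yes (no ¬p) p = contradiction p ¬p

  ind-no : (d : Dec P) → ¬ P → ind d ≡ 0ℚ
  ind-no (yes p) ¬p = contradiction p ¬p
  ind-no (no _)  _  = refl

  0≤ind : (d : Dec P) → 0ℚ ≤ ind d
  0≤ind (yes _) = 0≤1
  0≤ind (no _)  = ≤-refl

  ind≤1 : (d : Dec P) → ind d ≤ 1ℚ
  ind≤1 (yes _) = ≤-refl
  ind≤1 (no _)  = 0≤1

  ind-≤ : ∀ {q} (d : Dec P) → 0ℚ ≤ q → (P → 1ℚ ≤ q) → ind d ≤ q
  ind-≤ (yes p) _   1≤q = 1≤q p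
  ind-≤ (no _)  0≤q _   = 0≤q

  ind-mono : (d : Dec P) (d′ : Dec P′) → (P → P′) → ind d ≤ ind d′
  ind-mono (yes p) d′ f = ≤-reflexive (sym (ind-yes d′ (f p)))
  ind-mono (no _)  d′ f = 0≤ind d′

  ind-cong : (d : Dec P) (d′ : Dec P′) → (P → P′) → (P′ → P) → ind d ≡ ind d′
  ind-cong d d′ f g = ≤-antisym (ind-mono d d′ f) (ind-mono d′ d g)

  ind-⊎ : (d : Dec P) (d′ : Dec P′) (d″ : Dec P″) → (P → P′ ⊎ P″) → ind d ≤ ind d′ + ind d″
  ind-⊎ (no _)  d′ d″ f = 0≤+ (0≤ind d′) (0≤ind d″)
  ind-⊎ (yes p) d′ d″ f with f p
  ... | inj₁ p′ rewrite ind-yes d′ p′ = p≤p+q (0≤ind d″)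
  ... | inj₂ p″ rewrite ind-yes d″ p″ | +-comm (ind d′) 1ℚ = p≤p+q (0≤ind d′)

  ind-× : (d : Dec P) (d′ : Dec P′) → ind d * ind d′ ≡ ind (d ×-dec d′)
  ind-× (yes _) d′ = *-identityˡ _
  ind-× (no _)  d′ = *-zeroˡ (ind d′)

  -- Positive linear functionals: finite sums, sums over subsets, averages.

  record PositiveLinear (L : (X → ℚ) → ℚ) : Set where
    field
      additive    : ∀ f g → L (λ x → f x + g x) ≡ L f + L g
      homogeneous : ∀ c f → L (λ x → c * f x) ≡ c * L f
      monotone    : ∀ {f g} → (∀ x → f x ≤ g x) → L f ≤ L g

    ext : ∀ {f g} → (∀ x → f x ≡ g x) → L f ≡ L g
    ext e = ≤-antisym (monotone (≤-reflexive ∘ e)) (monotone (≤-reflexive ∘ sym ∘ e))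

    zeroed : L (λ _ → 0ℚ) ≡ 0ℚ
    zeroed = trans (ext (λ _ → sym (*-zeroˡ 0ℚ))) (trans (homogeneous 0ℚ (λ _ → 0ℚ)) (*-zeroˡ (L (λ _ → 0ℚ))))

    nonneg : ∀ {f} → (∀ x → 0ℚ ≤ f x) → 0ℚ ≤ L f
    nonneg 0≤f = subst (_≤ L _) zeroed (monotone 0≤f)

  open PositiveLinear public

  ∑ : ∀ {n} → (Fin n → ℚ) → ℚ
  ∑ {zero}  f = 0ℚ
  ∑ {suc n} f = f zero + ∑ (f ∘ suc)

  ∑ₛ : ∀ {n} → (Vec Bool n → ℚ) → ℚ
  ∑ₛ {zero}  f = f []
  ∑ₛ {suc n} f = ∑ₛ (f ∘ (true ∷_)) + ∑ₛ (f ∘ (false ∷_))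

  private
    interchange : ∀ a b c d → (a + b) + (c + d) ≡ (a + c) + (b + d)
    interchange = solve 4 (λ a b c d → (a :+ b) :+ (c :+ d) := (a :+ c) :+ (b :+ d)) refl

  ∑-linear : ∀ {n} → PositiveLinear (∑ {n})
  ∑-linear {zero} = record
    { additive = λ _ _ → refl ; homogeneous = λ c _ → sym (*-zeroʳ c) ; monotone = λ _ → ≤-refl }
  ∑-linear {suc n} = record
    { additive    = λ f g → trans (cong (f zero + g zero +_) (additive IH _ _)) (interchange (f zero) (g zero) _ _)
    ; homogeneous = λ c f → trans (cong (c * f zero +_) (homogeneous IH c _)) (sym (*-distribˡ-+ c _ _))
    ; monotone    = λ f≤g → +-mono-≤ (f≤g zero) (monotone IH (f≤g ∘ suc)) }
    where IH = ∑-linear {n}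

  ∑ₛ-linear : ∀ {n} → PositiveLinear (∑ₛ {n})
  ∑ₛ-linear {zero} = record { additive = λ _ _ → refl ; homogeneous = λ _ _ → refl ; monotone = λ f≤g → f≤g [] }
  ∑ₛ-linear {suc n} = record
    { additive    = λ f g → trans (cong₂ _+_ (additive IH _ _) (additive IH _ _))
                                  (interchange (∑ₛ (f ∘ (true ∷_))) (∑ₛ (g ∘ (true ∷_))) _ _)
    ; homogeneous = λ c f → trans (cong₂ _+_ (homogeneous IH c _) (homogeneous IH c _)) (sym (*-distribˡ-+ c _ _))
    ; monotone    = λ f≤g → +-mono-≤ (monotone IH (λ v → f≤g (true ∷ v))) (monotone IH (λ v → f≤g (false ∷ v))) }
    where IH = ∑ₛ-linear {n}

  avg-linear : ∀ (M σ : Vec Bool k) → PositiveLinear (resampleAvg M σ)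
  avg-linear [] [] = record { additive = λ _ _ → refl ; homogeneous = λ _ _ → refl ; monotone = λ f≤g → f≤g [] }
  avg-linear (false ∷ M) (b ∷ σ) = record
    { additive = λ _ _ → additive IH _ _ ; homogeneous = λ c _ → homogeneous IH c _
    ; monotone = λ f≤g → monotone IH (λ v → f≤g (b ∷ v)) }
    where IH = avg-linear M σ
  avg-linear (true ∷ M) (_ ∷ σ) = record
    { additive    = λ f g → trans (cong (½ *_) (trans (cong₂ _+_ (additive IH _ _) (additive IH _ _))
                                                     (interchange (L (f ∘ (true ∷_))) (L (g ∘ (true ∷_)))
                                                                  (L (f ∘ (false ∷_))) (L (g ∘ (false ∷_))))))
                                  (*-distribˡ-+ ½ (L (f ∘ (true ∷_)) + L (f ∘ (false ∷_)))
                                      (L (g ∘ (true ∷_)) + L (g ∘ (false ∷_))))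
    ; homogeneous = λ c f → trans (cong (½ *_) (cong₂ _+_ (homogeneous IH c _) (homogeneous IH c _)))
                                  (solve 4 (λ h c p q → h :* (c :* p :+ c :* q) := c :* (h :* (p :+ q))) refl
                                     ½ c (L (f ∘ (true ∷_))) (L (f ∘ (false ∷_))))
    ; monotone    = λ f≤g → *-monoʳ 0≤½ (+-mono-≤ (monotone IH (λ v → f≤g (true ∷ v)))
        (monotone IH (λ v → f≤g (false ∷ v)))) }
    where
    L  = resampleAvg M σ
    IH = avg-linear M σ

  uniform-linear : ∀ k → PositiveLinear (uniformAvg k)
  uniform-linear k = avg-linear (replicate k true) (replicate k false)

  -- With `L` an average this is linearity of expectation; with `L` a sum it is double counting, as
  -- in `count≤`.
  ∑-swap : ∀ {L : (X → ℚ) → ℚ} → PositiveLinear L → ∀ {n} (f : Fin n → X → ℚ) →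
           L (λ x → ∑ (λ i → f i x)) ≡ ∑ (λ i → L (f i))
  ∑-swap pl {zero}  f = zeroed pl
  ∑-swap {L = L} pl {suc n} f = trans (additive pl (f zero) _) (cong (L (f zero) +_) (∑-swap pl (f ∘ suc)))

  ∑ₛ-swap : ∀ {L : (X → ℚ) → ℚ} → PositiveLinear L → ∀ {n} (f : Vec Bool n → X → ℚ) →
            L (λ x → ∑ₛ (λ S → f S x)) ≡ ∑ₛ (λ S → L (f S))
  ∑ₛ-swap pl {zero}  f = refl
  ∑ₛ-swap pl {suc n} f = trans (additive pl _ _) (cong₂ _+_ (∑ₛ-swap pl (f ∘ (true ∷_))) (∑ₛ-swap pl (f ∘ (false ∷_))))

  term≤∑ : ∀ {n} {f : Fin n → ℚ} → (∀ i → 0ℚ ≤ f i) → ∀ i → f i ≤ ∑ f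
  term≤∑ 0≤f zero = p≤p+q (nonneg ∑-linear (0≤f ∘ suc))
  term≤∑ {f = f} 0≤f (suc i) =
    ≤-trans (term≤∑ (0≤f ∘ suc) i) (subst (_≤ ∑ f) (+-identityˡ (∑ (f ∘ suc))) (+-monoˡ-≤ (∑ (f ∘ suc)) (0≤f zero)))

  ∑-vanish : ∀ {n} {f : Fin n → ℚ} → (∀ i → f i ≡ 0ℚ) → ∑ f ≡ 0ℚ
  ∑-vanish {n} z = trans (ext (∑-linear {n}) z) (zeroed (∑-linear {n}))

  ∑ₛ-vanish : ∀ {n} {f : Vec Bool n → ℚ} → (∀ S → f S ≡ 0ℚ) → ∑ₛ f ≡ 0ℚ
  ∑ₛ-vanish {n} z = trans (ext (∑ₛ-linear {n}) z) (zeroed (∑ₛ-linear {n}))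

  ∑-single : ∀ {n} {f : Fin n → ℚ} i → (∀ j → j ≢ i → f j ≡ 0ℚ) → ∑ f ≡ f i
  ∑-single {f = f} zero z = trans (cong (f zero +_) (∑-vanish (λ j → z (suc j) λ ()))) (+-identityʳ (f zero))
  ∑-single {f = f} (suc i) z =
    trans (cong₂ _+_ (z zero λ ()) (∑-single i (λ j j≢i → z (suc j) (j≢i ∘ Fin.suc-injective))))
        (+-identityˡ (f (suc i)))

  ∑ₛ-single : ∀ {n} {f : Vec Bool n → ℚ} S → (∀ T → T ≢ S → f T ≡ 0ℚ) → ∑ₛ f ≡ f S
  ∑ₛ-single [] z = refl
  ∑ₛ-single {f = f} (true ∷ S) z =
    trans (cong₂ _+_ (∑ₛ-single S (λ T T≢S → z (true ∷ T) λ { refl → T≢S refl }))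
                     (∑ₛ-vanish (λ T → z (false ∷ T) λ ())))
          (+-identityʳ (f (true ∷ S)))
  ∑ₛ-single {f = f} (false ∷ S) z =
    trans (cong₂ _+_ (∑ₛ-vanish (λ T → z (true ∷ T) λ ()))
                     (∑ₛ-single S (λ T T≢S → z (false ∷ T) λ { refl → T≢S refl })))
          (+-identityˡ (f (false ∷ S)))

  ∑-atMostOne : ∀ {n} {P : Fin n → Set} (P? : ∀ i → Dec (P i)) → (∀ {i j} → P i → P j → i ≡ j) →
                ∑ (λ i → ind (P? i)) ≤ 1ℚ
  ∑-atMostOne P? unique with Fin.any? P?
  ... | yes (i , p) = subst (_≤ 1ℚ) (sym (∑-single i λ j j≢i → ind-no (P? j) λ q → j≢i (unique q p))) (ind≤1 (P? i))
  ... | no ¬∃       = subst (_≤ 1ℚ) (sym (∑-vanish λ i → ind-no (P? i) λ p → ¬∃ (i , p))) 0≤1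

  -- Independence of resampled and kept bits.

  avg-const : ∀ (M σ : Vec Bool k) c → resampleAvg M σ (λ _ → c) ≡ c
  avg-const [] [] c = refl
  avg-const (false ∷ M) (_ ∷ σ) c = avg-const M σ c
  avg-const (true ∷ M)  (_ ∷ σ) c rewrite avg-const M σ c = ½-double c

  -- Invariance under `Agree M b` expresses that a function depends only on the coordinates where
  -- the mask is `b`, without restricting vectors to those coordinates.
  Agree : Vec Bool k → Bool → Vec Bool k → Vec Bool k → Set
  Agree M b σ τ = ∀ i → lookup M i ≡ b → lookup σ i ≡ lookup τ i

  private
    agree-∷ : ∀ {M : Vec Bool k} {b σ τ} c d → Agree M b σ τ → Agree (d ∷ M) b (c ∷ σ) (c ∷ τ)
    agree-∷ c d a zero    _ = refl
    agree-∷ c d a (suc i) e = a i e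

    agree-head : ∀ {M : Vec Bool k} {b c d} → d ≢ b → ∀ c′ σ → Agree (d ∷ M) b (c ∷ σ) (c′ ∷ σ)
    agree-head d≢b c′ σ zero    e = contradiction e d≢b
    agree-head d≢b c′ σ (suc i) e = refl

  -- The old values of the masked bits are seen only by `f`, and the vector fed to `F` has fresh
  -- values there. Together with the kept bits, on which alone `g` depends, these fresh bits form a
  -- uniform vector independent of the old masked bits.
  avg-product : ∀ (M : Vec Bool k) (f g F : Vec Bool k → ℚ) →
    (∀ σ τ → Agree M true σ τ → f σ ≡ f τ) → (∀ σ τ → Agree M false σ τ → g σ ≡ g τ) →
    uniformAvg k (λ σ → f σ * g σ * resampleAvg M σ F) ≡ uniformAvg k f * uniformAvg k (λ σ → g σ * F σ)
  avg-product [] f g F onM offM = *-assoc (f []) (g []) (F [])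
  avg-product {suc k} (true ∷ M) f g F onM offM = begin
    ½ * (L (λ σ → f (true ∷ σ) * g (true ∷ σ) * A σ) + L (λ σ → f (false ∷ σ) * g (false ∷ σ) * A σ))
      ≡⟨ cong (½ *_) (cong₂ _+_ (half true) (half false)) ⟩
    ½ * (½ * (fₜ * (gFₜ + gFₓ)) + ½ * (fₓ * (gFₜ + gFₓ)))
      ≡⟨ solve 4 (λ h a b c → h :* (h :* (a :* c) :+ h :* (b :* c)) := h :* (a :+ b) :* (h :* c)) refl ½ fₜ fₓ
          (gFₜ + gFₓ) ⟩
    ½ * (fₜ + fₓ) * (½ * (gFₜ + gFₓ)) ∎
    where
    open ≡-Reasoning
    L  = uniformAvg k
    PL = uniform-linear k
    A  : Vec Bool k → ℚ
    A σ = ½ * (resampleAvg M σ (F ∘ (true ∷_)) + resampleAvg M σ (F ∘ (false ∷_)))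
    fₜ = L (f ∘ (true ∷_))
    fₓ = L (f ∘ (false ∷_))
    gFₜ = L (λ σ → g (true ∷ σ) * F (true ∷ σ))
    gFₓ = L (λ σ → g (false ∷ σ) * F (false ∷ σ))
    -- `g` ignores a masked bit, so its old value `b` may be replaced by the fresh value `c`, the
    -- one that `F` receives.
    g-free : ∀ b c σ → g (b ∷ σ) ≡ g (c ∷ σ)
    g-free b c σ = offM (b ∷ σ) (c ∷ σ) (agree-head (λ ()) c σ)
    part : ∀ b c → L (λ σ → f (b ∷ σ) * g (b ∷ σ) * resampleAvg M σ (F ∘ (c ∷_)))
                 ≡ L (f ∘ (b ∷_)) * L (λ σ → g (c ∷ σ) * F (c ∷ σ))
    part b c = trans (avg-product M (f ∘ (b ∷_)) (g ∘ (b ∷_)) (F ∘ (c ∷_))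
        (λ σ τ a → onM (b ∷ σ) (b ∷ τ) (agree-∷ b true a)) (λ σ τ a → offM (b ∷ σ) (b ∷ τ) (agree-∷ b true a)))
                     (cong (L (f ∘ (b ∷_)) *_) (ext PL (λ σ → cong (_* F (c ∷ σ)) (g-free b c σ))))
    half : ∀ b → L (λ σ → f (b ∷ σ) * g (b ∷ σ) * A σ) ≡ ½ * (L (f ∘ (b ∷_)) * (gFₜ + gFₓ))
    half b = begin
      L (λ σ → f (b ∷ σ) * g (b ∷ σ) * A σ)
        ≡⟨ ext PL (λ σ → solve 4 (λ h a p q → a :* (h :* (p :+ q)) := h :* (a :* p :+ a :* q)) refl ½
                           (f (b ∷ σ) * g (b ∷ σ)) (resampleAvg M σ (F ∘ (true ∷_)))
                               (resampleAvg M σ (F ∘ (false ∷_)))) ⟩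
      L (λ σ → ½ * (f (b ∷ σ) * g (b ∷ σ) * resampleAvg M σ (F ∘ (true ∷_)) + f (b ∷ σ) * g (b ∷ σ) * resampleAvg M σ
          (F ∘ (false ∷_))))
        ≡⟨ homogeneous PL ½ _ ⟩
      ½ * L (λ σ → f (b ∷ σ) * g (b ∷ σ) * resampleAvg M σ (F ∘ (true ∷_)) + f (b ∷ σ) * g (b ∷ σ) * resampleAvg M σ
          (F ∘ (false ∷_)))
        ≡⟨ cong (½ *_) (additive PL _ _) ⟩
      ½ * (L (λ σ → f (b ∷ σ) * g (b ∷ σ) * resampleAvg M σ (F ∘ (true ∷_))) + L
          (λ σ → f (b ∷ σ) * g (b ∷ σ) * resampleAvg M σ (F ∘ (false ∷_))))
        ≡⟨ cong (½ *_) (cong₂ _+_ (part b true) (part b false)) ⟩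
      ½ * (L (f ∘ (b ∷_)) * gFₜ + L (f ∘ (b ∷_)) * gFₓ)
        ≡⟨ cong (½ *_) (sym (*-distribˡ-+ (L (f ∘ (b ∷_))) gFₜ gFₓ)) ⟩
      ½ * (L (f ∘ (b ∷_)) * (gFₜ + gFₓ)) ∎
  avg-product {suc k} (false ∷ M) f g F onM offM = begin
    ½ * (L (λ σ → f (true ∷ σ) * g (true ∷ σ) * resampleAvg M σ (F ∘ (true ∷_))) + L
        (λ σ → f (false ∷ σ) * g (false ∷ σ) * resampleAvg M σ (F ∘ (false ∷_))))
      ≡⟨ cong (½ *_) (cong₂ _+_ (part true) (part false)) ⟩
    ½ * (fₜ * gF true + L (f ∘ (false ∷_)) * gF false)
      ≡⟨ cong (λ z → ½ * (fₜ * gF true + z * gF false)) (sym fₜ≡fₓ) ⟩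
    ½ * (fₜ * gF true + fₜ * gF false)
      ≡⟨ solve 4 (λ h a p q → h :* (a :* p :+ a :* q) := a :* (h :* (p :+ q))) refl ½ fₜ (gF true) (gF false) ⟩
    fₜ * (½ * (gF true + gF false))
      ≡⟨ cong (_* (½ * (gF true + gF false))) (trans (sym (½-double fₜ)) (cong (λ z → ½ * (fₜ + z)) fₜ≡fₓ)) ⟩
    ½ * (fₜ + L (f ∘ (false ∷_))) * (½ * (gF true + gF false)) ∎
    where
    open ≡-Reasoning
    L  = uniformAvg k
    PL = uniform-linear k
    fₜ = L (f ∘ (true ∷_))
    gF : Bool → ℚ
    gF b = L (λ σ → g (b ∷ σ) * F (b ∷ σ))
    fₜ≡fₓ : fₜ ≡ L (f ∘ (false ∷_))
    fₜ≡fₓ = ext PL (λ σ → onM (true ∷ σ) (false ∷ σ) (agree-head (λ ()) false σ))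
    part : ∀ b → L (λ σ → f (b ∷ σ) * g (b ∷ σ) * resampleAvg M σ (F ∘ (b ∷_))) ≡ L (f ∘ (b ∷_)) * gF b
    part b = avg-product M (f ∘ (b ∷_)) (g ∘ (b ∷_)) (F ∘ (b ∷_)) (λ σ τ a → onM (b ∷ σ) (b ∷ τ) (agree-∷ b false a))
        (λ σ τ a → offM (b ∷ σ) (b ∷ τ) (agree-∷ b false a))

  -- Finite subsets, Boolean search, maxima over subsets.

  _≟ₛ_ : (S T : Subset k) → Dec (S ≡ T)
  _≟ₛ_ = Vec.≡-dec Bool._≟_

  does-true : ∀ {P : Set} (d : Dec P) → does d ≡ true → P
  does-true (yes p) _ = p

  ⟦_⟧ : {P : Fin k → Set} → (∀ i → Dec (P i)) → Subset k
  ⟦ P? ⟧ = tabulate (does ∘ P?)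

  ∈⟦⟧⁺ : ∀ {P : Fin k → Set} (P? : ∀ i → Dec (P i)) {i} → P i → i ∈ ⟦ P? ⟧
  ∈⟦⟧⁺ P? {i} p = lookup⇒[]= i _ (trans (lookup∘tabulate _ i) (dec-true (P? i) p))

  ∈⟦⟧⁻ : ∀ {P : Fin k → Set} (P? : ∀ i → Dec (P i)) {i} → i ∈ ⟦ P? ⟧ → P i
  ∈⟦⟧⁻ P? {i} i∈ = does-true (P? i) (trans (sym (lookup∘tabulate (does ∘ P?) i)) ([]=⇒lookup i∈))

  ∉p-x : ∀ (p : Subset k) x → x ∉ p - x
  ∉p-x (b ∷ p) (suc x) (Data.Vec.there x∈) = ∉p-x p x x∈
  ∉p-x (true  ∷ p) zero ()
  ∉p-x (false ∷ p) zero ()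

  any⁺ : ∀ (p : Fin k → Bool) {i} → p i ≡ true → any p (allFin k) ≡ true
  any⁺ p {i} pi = Equivalence.to Bool.T-≡ (Any.any⁺ p (lose (∈-allFin i) (Equivalence.from Bool.T-≡ pi)))

  any⁻ : ∀ (p : Fin k → Bool) → any p (allFin k) ≡ true → ∃ λ i → p i ≡ true
  any⁻ p e with satisfied (Any.any⁻ p (allFin _) (Equivalence.from Bool.T-≡ e))
  ... | i , pi = i , Equivalence.to Bool.T-≡ pi

  maximum : (f : Vec Bool k → ℚ) → ∃ λ S → ∀ T → f T ≤ f S
  maximum {zero} f = [] , λ { [] → ≤-refl }
  maximum {suc k} f with maximum (f ∘ (true ∷_)) | maximum (f ∘ (false ∷_))
  ... | S , S-max | T , T-max with ≤-total (f (true ∷ S)) (f (false ∷ T))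
  ... | inj₁ le = false ∷ T , λ { (true ∷ R) → ≤-trans (S-max R) le ; (false ∷ R) → T-max R }
  ... | inj₂ le = true ∷ S , λ { (true ∷ R) → S-max R ; (false ∷ R) → ≤-trans (T-max R) le }

  -- Sinks and the edges that decide them.

  module Sinks {n m : ℕ} (E : Fin m → Fin n × Fin n) where

    tail : Orientation m → Fin m → Fin n
    tail σ i = tailOf (E i) (lookup σ i)

    sinks : Orientation m → Subset n
    sinks σ = tabulate (isSink E σ)

    ∈sinks⁻ : ∀ σ {z} → z ∈ sinks σ → ∀ i → tail σ i ≢ z
    ∈sinks⁻ σ {z} z∈ i eq with hasOut E σ z in out | trans (sym (lookup∘tabulate (isSink E σ) z)) ([]=⇒lookup z∈)
    ... | true  | ()
    ... | false | _ = contradiction (trans (sym out) (any⁺ _ {i} (dec-true (tail σ i Fin.≟ z) eq))) λ ()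

    ∈sinks⁺ : ∀ σ {z} → (∀ i → tail σ i ≢ z) → z ∈ sinks σ
    ∈sinks⁺ σ {z} ¬out = lookup⇒[]= z _ (trans (lookup∘tabulate (isSink E σ) z) sink)
      where
      sink : isSink E σ z ≡ true
      sink with hasOut E σ z in out
      ... | false = refl
      ... | true with any⁻ (λ i → does (tail σ i Fin.≟ z)) out
      ... | i , eq = contradiction (does-true (tail σ i Fin.≟ z) eq) (¬out i)

    out⇒∉sinks : ∀ σ {z i} → tail σ i ≡ z → z ∉ sinks σ
    out⇒∉sinks σ {i = i} eq z∈ = ∈sinks⁻ σ z∈ i eq

    hasSink⇔ : ∀ σ → hasSink E σ ≡ does (nonempty? (sinks σ))
    hasSink⇔ σ with nonempty? (sinks σ)
    ... | yes (z , z∈) = any⁺ (isSink E σ) (trans (sym (lookup∘tabulate (isSink E σ) z)) ([]=⇒lookup z∈))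
    ... | no ¬∃ with hasSink E σ in eq
    ... | false = refl
    ... | true with any⁻ (isSink E σ) eq
    ... | z , e = contradiction (z , lookup⇒[]= z _ (trans (lookup∘tabulate (isSink E σ) z) e)) ¬∃

    -- Defined for an arbitrary `S` rather than for the sinks of an orientation: with `S` fixed in
    -- advance the set of redrawn edges is deterministic, as `avg-product` requires.
    mask : Subset n → Vec Bool m
    mask S = tabulate λ i → lookup S (proj₁ (E i)) ∨ lookup S (proj₂ (E i))

    resampleMask≡mask : ∀ σ → resampleMask E σ ≡ mask (sinks σ)
    resampleMask≡mask σ = tabulate-cong λ i →
      sym (cong₂ _∨_ (lookup∘tabulate (isSink E σ) (proj₁ (E i))) (lookup∘tabulate (isSink E σ) (proj₂ (E i))))

    Touches : Fin m → Fin n → Set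
    Touches i z = proj₁ (E i) ≡ z ⊎ proj₂ (E i) ≡ z

    touches? : ∀ i z → Dec (Touches i z)
    touches? i z = (proj₁ (E i) Fin.≟ z) ⊎-dec (proj₂ (E i) Fin.≟ z)

    tail-touches : ∀ σ i {z} → tail σ i ≡ z → Touches i z
    tail-touches σ i with lookup σ i
    ... | true  = inj₁
    ... | false = inj₂

    mask-touches⁺ : ∀ {S i z} → z ∈ S → Touches i z → lookup (mask S) i ≡ true
    mask-touches⁺ {S} {i} {z} z∈ t rewrite lookup∘tabulate (λ i → lookup S (proj₁ (E i)) ∨ lookup S (proj₂ (E i))) i
        with t
    ... | inj₁ refl rewrite []=⇒lookup z∈ = refl
    ... | inj₂ refl rewrite []=⇒lookup z∈ = Bool.∨-zeroʳ _

    mask-touches⁻ : ∀ {S i} → lookup (mask S) i ≡ true → ∃ λ z → z ∈ S × Touches i z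
    mask-touches⁻ {S} {i} e rewrite lookup∘tabulate (λ i → lookup S (proj₁ (E i)) ∨ lookup S (proj₂ (E i))) i
      with lookup S (proj₁ (E i)) in e₁ | lookup S (proj₂ (E i)) in e₂
    ... | true  | _    = proj₁ (E i) , lookup⇒[]= _ S e₁ , inj₁ refl
    ... | false | true = proj₂ (E i) , lookup⇒[]= _ S e₂ , inj₂ refl

    private
      near? : ∀ S z → Dec (z ∈ S ⊎ ∃ λ i → Touches i z × lookup (mask S) i ≡ true)
      near? S z = (z ∈? S) ⊎-dec Fin.any? λ i → touches? i z ×-dec (lookup (mask S) i Bool.≟ true)

    -- Phrased through the mask, since what matters is that every edge at a vertex outside it is
    -- kept when `mask S` is redrawn.
    closedNbhd : Subset n → Subset n
    closedNbhd S = ⟦ near? S ⟧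

    ⊆closedNbhd : ∀ {S} → S ⊆ closedNbhd S
    ⊆closedNbhd {S} z∈ = ∈⟦⟧⁺ (near? S) (inj₁ z∈)

    two-ends : ∀ σ i {y z} → Touches i y → Touches i z → y ≢ z → tail σ i ≡ y ⊎ tail σ i ≡ z
    two-ends σ i t u y≢z with lookup σ i
    two-ends σ i (inj₁ p) _        y≢z | true  = inj₁ p
    two-ends σ i (inj₂ p) (inj₁ q) y≢z | true  = inj₂ q
    two-ends σ i (inj₂ p) (inj₂ q) y≢z | true  = contradiction (trans (sym p) q) y≢z
    two-ends σ i (inj₂ p) _        y≢z | false = inj₁ p
    two-ends σ i (inj₁ p) (inj₂ q) y≢z | false = inj₂ q
    two-ends σ i (inj₁ p) (inj₁ q) y≢z | false = contradiction (trans (sym p) q) y≢z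

    -- Every edge has a tail, so two sinks are never adjacent.
    sinks∩nbhd : ∀ σ {S z} → S ⊆ sinks σ → z ∈ sinks σ → z ∈ closedNbhd S → z ∈ S
    sinks∩nbhd σ {S} {z} S⊆ z∈ z∈N with z ∈? S
    ... | yes z∈S = z∈S
    ... | no z∉S with ∈⟦⟧⁻ (near? S) z∈N
    ... | inj₁ z∈S = z∈S
    ... | inj₂ (i , t , e) with mask-touches⁻ {S} e
    ... | y , y∈S , u with two-ends σ i u t (λ { refl → z∉S y∈S })
    ... | inj₁ eq = contradiction eq (∈sinks⁻ σ (S⊆ y∈S) i)
    ... | inj₂ eq = contradiction eq (∈sinks⁻ σ z∈ i)

    -- Every edge at a vertex of `S` lies in the mask, so whether that vertex is a sink is read off
    -- the masked edges alone.
    sinks-on-mask : ∀ S σ τ {z} → Agree (mask S) true σ τ → z ∈ S → z ∈ sinks σ → z ∈ sinks τ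
    sinks-on-mask S σ τ agree z∈S z∈ = ∈sinks⁺ τ λ i eq → ∈sinks⁻ σ z∈ i
      (trans (cong (tailOf (E i)) (agree i (mask-touches⁺ {S} z∈S (tail-touches τ i eq)))) eq)

    -- No edge at a vertex outside the closed neighbourhood is masked, so the kept edges decide
    -- whether it is a sink.
    sinks-off-mask : ∀ S σ τ {z} → Agree (mask S) false σ τ → z ∉ closedNbhd S → z ∈ sinks σ → z ∈ sinks τ
    sinks-off-mask S σ τ agree z∉N z∈ = ∈sinks⁺ τ λ i eq → ∈sinks⁻ σ z∈ i
      (trans (cong (tailOf (E i)) (agree i (off i (tail-touches τ i eq)))) eq)
      where
      off : ∀ i → Touches i _ → lookup (mask S) i ≡ false
      off i t with lookup (mask S) i in e
      ... | false = refl
      ... | true  = contradiction (∈⟦⟧⁺ (near? S) (inj₂ (i , t , e))) z∉N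

  term≤∑ₛ : ∀ {n} {f : Vec Bool n → ℚ} → (∀ S → 0ℚ ≤ f S) → ∀ S → f S ≤ ∑ₛ f
  term≤∑ₛ 0≤f [] = ≤-refl
  term≤∑ₛ {f = f} 0≤f (true ∷ S) =
    ≤-trans (term≤∑ₛ (0≤f ∘ (true ∷_)) S) (p≤p+q (nonneg ∑ₛ-linear (0≤f ∘ (false ∷_))))
  term≤∑ₛ {f = f} 0≤f (false ∷ S) =
    ≤-trans (term≤∑ₛ (0≤f ∘ (false ∷_)) S)
            (subst (∑ₛ (f ∘ (false ∷_)) ≤_) (+-comm _ (∑ₛ (f ∘ (true ∷_))))
                (p≤p+q (nonneg ∑ₛ-linear (0≤f ∘ (true ∷_)))))

  +-cancelʳ-≤ : ∀ {p q} r → p + r ≤ q + r → p ≤ q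
  +-cancelʳ-≤ {p} {q} r le = subst₂ _≤_ (undo p) (undo q) (+-monoˡ-≤ (- r) le)
    where
    undo : ∀ x → x + r + - r ≡ x
    undo x = trans (+-assoc x r (- r)) (trans (cong (x +_) (+-inverseʳ r)) (+-identityʳ x))

  inverse : ∀ {p} → 0ℚ < p → ∃ λ q → 0ℚ ≤ q × q * p ≡ 1ℚ
  inverse {p} 0<p = 1/ p , <⇒≤ (positive⁻¹ (1/ p) {{1/pos⇒pos p}}) , *-inverseˡ p
    where instance
      p-pos = positive 0<p
      p-nz  = pos⇒nonZero p

  -- The law of the process and the recursions over sets of allowed sinks.

  module Popping {n m : ℕ} (E : Fin m → Fin n × Fin n) where
    open Sinks E

    𝔼 : (Orientation m → ℚ) → ℚ
    𝔼 = uniformAvg m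

    𝔼-linear : PositiveLinear 𝔼
    𝔼-linear = uniform-linear m

    Pr : {P : Orientation m → Set} → (∀ σ → Dec (P σ)) → ℚ
    Pr P? = 𝔼 λ σ → ind (P? σ)

    0≤Pr : {P : Orientation m → Set} (P? : ∀ σ → Dec (P σ)) → 0ℚ ≤ Pr P?
    0≤Pr P? = nonneg 𝔼-linear (λ σ → 0≤ind (P? σ))

    Pr-mono : {P P′ : Orientation m → Set} (P? : ∀ σ → Dec (P σ)) (P′? : ∀ σ → Dec (P′ σ)) →
              (∀ σ → P σ → P′ σ) → Pr P? ≤ Pr P′?
    Pr-mono P? P′? f = monotone 𝔼-linear λ σ → ind-mono (P? σ) (P′? σ) (f σ)

    within? : ∀ U σ → Dec (sinks σ ⊆ U)
    within? U σ = sinks σ ⊆? U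

    sinkWithin? : ∀ U v σ → Dec (v ∈ sinks σ × sinks σ ⊆ U)
    sinkWithin? U v σ = (v ∈? sinks σ) ×-dec within? U σ

    sinkBeyond? : ∀ U v σ → Dec (v ∈ sinks σ × sinks σ ⊆ U ∪ ⁅ v ⁆)
    sinkBeyond? U v = sinkWithin? (U ∪ ⁅ v ⁆) v

    Q : Subset n → ℚ
    Q U = Pr (within? U)

    R : Subset n → Fin n → ℚ
    R U v = Pr (sinkBeyond? U v)

    -- `R₀` is `R` cut down to 0 when `v` lies in `U`, whereas `W` vanishes when `v` lies outside
    -- `U`. So for each `U` at most one of the two is nonzero, which is why `R-split` holds.
    strictly? : ∀ U v σ → Dec (v ∉ U × v ∈ sinks σ × sinks σ ⊆ U ∪ ⁅ v ⁆)
    strictly? U v σ = ¬? (v ∈? U) ×-dec sinkBeyond? U v σ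

    R₀ : Fin n → Subset n → ℚ
    R₀ v U = Pr (strictly? U v)

    W : Fin n → Subset n → ℚ
    W v U = Pr (sinkWithin? U v)

    first? : ∀ (U S : Subset n) → Dec (S ⊆ U × Nonempty S)
    first? U S = (S ⊆? U) ×-dec nonempty? S

    allSinks? : ∀ S σ → Dec (S ⊆ sinks σ)
    allSinks? S σ = S ⊆? sinks σ

    -- Sum over the possible first nonempty sink sets S ⊆ U, each followed by a uniform orientation without sinks outside
    -- closedNbhd S.
    layer : (Subset n → ℚ) → Subset n → ℚ
    layer Φ U = ∑ₛ λ S → ind (first? U S) * (Pr (allSinks? S) * Φ (closedNbhd S))

    layer-linear : ∀ U → PositiveLinear (λ Φ → layer Φ U)
    layer-linear U = record
      { additive    = λ Φ Ψ → trans (ext ∑ₛ-linear λ S →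
          solve 4 (λ a b p q → a :* (b :* (p :+ q)) := a :* (b :* p) :+ a :* (b :* q)) refl
            (ind (first? U S)) (Pr (allSinks? S)) (Φ (closedNbhd S)) (Ψ (closedNbhd S)))
          (additive ∑ₛ-linear (λ S → ind (first? U S) * (Pr (allSinks? S) * Φ (closedNbhd S))) _)
      ; homogeneous = λ c Φ → trans (ext ∑ₛ-linear λ S →
          solve 4 (λ a b c p → a :* (b :* (c :* p)) := c :* (a :* (b :* p))) refl
            (ind (first? U S)) (Pr (allSinks? S)) c (Φ (closedNbhd S)))
          (homogeneous (∑ₛ-linear {n}) c (λ S → ind (first? U S) * (Pr (allSinks? S) * Φ (closedNbhd S))))
      ; monotone    = λ Φ≤Ψ → monotone ∑ₛ-linear λ S →
          *-monoʳ (0≤ind (first? U S)) (*-monoʳ (0≤Pr (allSinks? S)) (Φ≤Ψ (closedNbhd S))) }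

    allSinks-local : ∀ S σ τ → Agree (mask S) true σ τ → ind (allSinks? S σ) ≡ ind (allSinks? S τ)
    allSinks-local S σ τ a = ind-cong (allSinks? S σ) (allSinks? S τ)
      (λ S⊆ z∈ → sinks-on-mask S σ τ a z∈ (S⊆ z∈)) (λ S⊆ z∈ → sinks-on-mask S τ σ (λ i e → sym (a i e)) z∈ (S⊆ z∈))

    within-mono : ∀ S {U} → closedNbhd S ⊆ U → ∀ σ τ → Agree (mask S) false σ τ → sinks σ ⊆ U → sinks τ ⊆ U
    within-mono S N⊆U σ τ a Z⊆ {z} z∈ with z ∈? closedNbhd S
    ... | yes z∈N = N⊆U z∈N
    ... | no z∉N  = Z⊆ (sinks-off-mask S τ σ (λ i e → sym (a i e)) z∉N z∈)

    -- S ⊆ sinks σ depends only on the resampled edges, sinks σ ⊆ closedNbhd S only on the others.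
    resample-exact : ∀ S F → 𝔼 (λ σ → ind (sinks σ ≟ₛ S) * resampleAvg (mask S) σ F)
                           ≡ Pr (allSinks? S) * 𝔼 (λ σ → ind (within? (closedNbhd S) σ) * F σ)
    resample-exact S F = trans (ext 𝔼-linear λ σ → cong (_* resampleAvg (mask S) σ F) (exact σ))
      (avg-product (mask S) _ _ F (allSinks-local S)
        (λ σ τ a → ind-cong (within? N σ) (within? N τ) (within-mono S (λ z → z) σ τ a)
            (within-mono S (λ z → z) τ σ (λ i e → sym (a i e)))))
      where
      N = closedNbhd S
      exact : ∀ σ → ind (sinks σ ≟ₛ S) ≡ ind (allSinks? S σ) * ind (within? N σ)
      exact σ = trans (ind-cong (sinks σ ≟ₛ S) (allSinks? S σ ×-dec within? N σ)
                        (λ { refl → (λ z → z) , ⊆closedNbhd {sinks σ} })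
                        (λ (S⊆ , ⊆N) → ⊆-antisym (λ z∈ → sinks∩nbhd σ S⊆ z∈ (⊆N z∈)) S⊆))
                      (sym (ind-× (allSinks? S σ) (within? N σ)))

    -- The mask depends on the random sink set. Summing over the possible values `S` of that set
    -- makes it deterministic in each term, and `resample-exact` applies.
    resample-layer : ∀ U F → 𝔼 (λ σ → ind (first? U (sinks σ)) * resampleAvg (mask (sinks σ)) σ F)
                           ≡ layer (λ N → 𝔼 (λ σ → ind (within? N σ) * F σ)) U
    resample-layer U F = begin
      𝔼 (λ σ → ind (first? U (sinks σ)) * resampleAvg (mask (sinks σ)) σ F)
        ≡⟨ ext 𝔼-linear (λ σ → sym (expand σ)) ⟩
      𝔼 (λ σ → ∑ₛ (λ S → ind (first? U S) * (ind (sinks σ ≟ₛ S) * resampleAvg (mask S) σ F)))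
        ≡⟨ ∑ₛ-swap 𝔼-linear (λ S σ → ind (first? U S) * (ind (sinks σ ≟ₛ S) * resampleAvg (mask S) σ F)) ⟩
      ∑ₛ (λ S → 𝔼 (λ σ → ind (first? U S) * (ind (sinks σ ≟ₛ S) * resampleAvg (mask S) σ F)))
        ≡⟨ ext ∑ₛ-linear (λ S → trans (homogeneous 𝔼-linear (ind (first? U S)) _)
            (cong (ind (first? U S) *_) (resample-exact S F))) ⟩
      layer (λ N → 𝔼 (λ σ → ind (within? N σ) * F σ)) U ∎
      where
      open ≡-Reasoning
      expand : ∀ σ → ∑ₛ (λ S → ind (first? U S) * (ind (sinks σ ≟ₛ S) * resampleAvg (mask S) σ F))
                   ≡ ind (first? U (sinks σ)) * resampleAvg (mask (sinks σ)) σ F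
      expand σ = trans
        (∑ₛ-single (sinks σ) λ S S≢ → trans (cong (λ z → ind (first? U S) * (z * resampleAvg (mask S) σ F))
            (ind-no (sinks σ ≟ₛ S) (S≢ ∘ sym)))
                                           (trans (cong (ind (first? U S) *_) (*-zeroˡ (resampleAvg (mask S) σ F)))
                                               (*-zeroʳ (ind (first? U S)))))
        (trans (cong (λ z → ind (first? U (sinks σ)) * (z * resampleAvg (mask (sinks σ)) σ F))
            (ind-yes (sinks σ ≟ₛ sinks σ) refl))
               (cong (ind (first? U (sinks σ)) *_) (*-identityˡ _)))

    -- Either there is no sink or the sink set is nonempty and inside `U`. Inserting a resampling
    -- average of the constant 1 brings the second case into the form of `resample-layer`.
    Q-layer : ∀ U → Q U ≡ Q ⊥ + layer Q U
    Q-layer U = begin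
      Q U ≡⟨ ext 𝔼-linear split ⟩
      𝔼 (λ σ → ind (within? ⊥ σ) + ind (first? U (sinks σ)) * resampleAvg (mask (sinks σ)) σ (λ _ → 1ℚ))
        ≡⟨ additive 𝔼-linear _ _ ⟩
      Q ⊥ + 𝔼 (λ σ → ind (first? U (sinks σ)) * resampleAvg (mask (sinks σ)) σ (λ _ → 1ℚ))
        ≡⟨ cong (Q ⊥ +_) (resample-layer U (λ _ → 1ℚ)) ⟩
      Q ⊥ + layer (λ N → 𝔼 (λ σ → ind (within? N σ) * 1ℚ)) U
        ≡⟨ cong (Q ⊥ +_) (ext (layer-linear U) λ N → ext 𝔼-linear λ σ → *-identityʳ (ind (within? N σ))) ⟩
      Q ⊥ + layer Q U ∎
      where
      open ≡-Reasoning
      split : ∀ σ → ind (within? U σ) ≡ ind (within? ⊥ σ) + ind (first? U (sinks σ)) * resampleAvg (mask (sinks σ)) σ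
          (λ _ → 1ℚ)
      split σ = trans (cases (nonempty? (sinks σ))) (cong (ind (within? ⊥ σ) +_)
        (sym (trans (cong (ind (first? U (sinks σ)) *_) (avg-const (mask (sinks σ)) σ 1ℚ))
            (*-identityʳ (ind (first? U (sinks σ)))))))
        where
        cases : Dec (Nonempty (sinks σ)) → ind (within? U σ) ≡ ind (within? ⊥ σ) + ind (first? U (sinks σ))
        cases (no ¬∃) = trans (trans (ind-yes (within? U σ) (λ z∈ → contradiction (_ , z∈) ¬∃)) (sym (+-identityʳ 1ℚ)))
                              (sym (cong₂ _+_ (ind-yes (within? ⊥ σ) (λ z∈ → contradiction (_ , z∈) ¬∃))
                                              (ind-no (first? U (sinks σ)) (¬∃ ∘ proj₂))))
        cases (yes ne) = trans (sym (+-identityˡ (ind (within? U σ))))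
                               (cong₂ _+_ (sym (ind-no (within? ⊥ σ) (λ ⊆⊥ → ∉⊥ (⊆⊥ (proj₂ ne)))))
                                          (ind-cong (within? U σ) (first? U (sinks σ)) (λ Z⊆ → Z⊆ , ne) proj₁))

    -- Split by the set `S` of sinks other than `v`. The case of empty `S` gives `R ⊥ v`. Otherwise
    -- `v` is not adjacent to `S`, because two sinks never are, so it lies outside `closedNbhd S`.
    -- Then the event that `S` consists of sinks is independent of the event, decided by the kept
    -- edges, that defines `R₀ v (closedNbhd S)`.
    R-layer : ∀ U v → R U v ≤ R ⊥ v + layer (R₀ v) U
    R-layer U v = begin
      R U v ≤⟨ monotone 𝔼-linear pointwise ⟩
      𝔼 (λ σ → ind (sinkBeyond? ⊥ v σ) + ∑ₛ (λ S → ind (first? U S) * ind (plus? S σ)))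
        ≡⟨ additive 𝔼-linear _ _ ⟩
      R ⊥ v + 𝔼 (λ σ → ∑ₛ (λ S → ind (first? U S) * ind (plus? S σ)))
        ≡⟨ cong (R ⊥ v +_) (trans (∑ₛ-swap 𝔼-linear (λ S σ → ind (first? U S) * ind (plus? S σ)))
                                  (ext ∑ₛ-linear λ S → homogeneous 𝔼-linear (ind (first? U S)) _)) ⟩
      R ⊥ v + ∑ₛ (λ S → ind (first? U S) * Pr (plus? S))
        ≤⟨ +-monoʳ-≤ (R ⊥ v) (monotone ∑ₛ-linear λ S → *-monoʳ (0≤ind (first? U S)) (bound S)) ⟩
      R ⊥ v + layer (R₀ v) U ∎
      where
      open ≤-Reasoning
      plus? : ∀ S σ → Dec (v ∉ S × sinks σ ≡ S ∪ ⁅ v ⁆)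
      plus? S σ = ¬? (v ∈? S) ×-dec (sinks σ ≟ₛ (S ∪ ⁅ v ⁆))

      pointwise : ∀ σ → ind (sinkBeyond? U v σ) ≤ ind (sinkBeyond? ⊥ v σ) + ∑ₛ
          (λ S → ind (first? U S) * ind (plus? S σ))
      pointwise σ = ind-≤ (sinkBeyond? U v σ) (0≤+ (0≤ind (sinkBeyond? ⊥ v σ)) 0≤sum) λ (v∈ , Z⊆) → cases v∈ Z⊆
          (nonempty? S)
        where
        S = sinks σ - v
        summand : Subset n → ℚ
        summand T = ind (first? U T) * ind (plus? T σ)
        0≤summand : ∀ T → 0ℚ ≤ summand T
        0≤summand T = 0≤* (0≤ind (first? U T)) (0≤ind (plus? T σ))
        0≤sum : 0ℚ ≤ ∑ₛ summand
        0≤sum = nonneg ∑ₛ-linear 0≤summand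

        cases : v ∈ sinks σ → sinks σ ⊆ U ∪ ⁅ v ⁆ → Dec (Nonempty S) → 1ℚ ≤ ind (sinkBeyond? ⊥ v σ) + ∑ₛ summand
        cases v∈ Z⊆ (no ¬∃) = ≤-trans (≤-reflexive (sym (ind-yes (sinkBeyond? ⊥ v σ) (v∈ , only)))) (p≤p+q 0≤sum)
          where
          only : sinks σ ⊆ ⊥ ∪ ⁅ v ⁆
          only {z} z∈ with z Fin.≟ v
          ... | yes refl = x∈p∪q⁺ (inj₂ (x∈⁅x⁆ v))
          ... | no z≢v = contradiction (z , x∈p∧x≢y⇒x∈p-y z∈ z≢v) ¬∃
        cases v∈ Z⊆ (yes ne) = begin
          1ℚ          ≡⟨ sym (cong₂ _*_ (ind-yes (first? U S) (S⊆U , ne))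
              (ind-yes (plus? S σ) (∉p-x (sinks σ) v , Z≡))) ⟩
          summand S   ≤⟨ term≤∑ₛ 0≤summand S ⟩
          ∑ₛ summand  ≤⟨ p≤q+p (0≤ind (sinkBeyond? ⊥ v σ)) ⟩
          ind (sinkBeyond? ⊥ v σ) + ∑ₛ summand ∎
          where
          S⊆U : S ⊆ U
          S⊆U {z} z∈ with x∈p∪q⁻ U ⁅ v ⁆ (Z⊆ (p─q⊆p (sinks σ) ⁅ v ⁆ z∈))
          ... | inj₁ z∈U = z∈U
          ... | inj₂ z∈v = contradiction (subst (_∈ S) (x∈⁅y⁆⇒x≡y v z∈v) z∈) (∉p-x (sinks σ) v)
          to : sinks σ ⊆ S ∪ ⁅ v ⁆
          to {z} z∈ with z Fin.≟ v
          ... | yes refl = x∈p∪q⁺ (inj₂ (x∈⁅x⁆ v))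
          ... | no z≢v = x∈p∪q⁺ (inj₁ (x∈p∧x≢y⇒x∈p-y z∈ z≢v))
          from : S ∪ ⁅ v ⁆ ⊆ sinks σ
          from {z} z∈ with x∈p∪q⁻ S ⁅ v ⁆ z∈
          ... | inj₁ z∈S = p─q⊆p (sinks σ) ⁅ v ⁆ z∈S
          ... | inj₂ z∈v = subst (_∈ sinks σ) (sym (x∈⁅y⁆⇒x≡y v z∈v)) v∈
          Z≡ : sinks σ ≡ S ∪ ⁅ v ⁆
          Z≡ = ⊆-antisym to from

      bound : ∀ S → Pr (plus? S) ≤ Pr (allSinks? S) * R₀ v (closedNbhd S)
      bound S = begin
        Pr (plus? S) ≤⟨ monotone 𝔼-linear dominated ⟩
        -- The average of 1 is a dummy factor that lets `avg-product` serve as plain independence of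
        -- two events.
        𝔼 (λ σ → ind (allSinks? S σ) * ind (strictly? N v σ) * resampleAvg (mask S) σ (λ _ → 1ℚ))
          ≡⟨ avg-product (mask S) _ _ (λ _ → 1ℚ) (allSinks-local S)
               (λ σ τ a → ind-cong (strictly? N v σ) (strictly? N v τ) (transfer σ τ a)
                   (transfer τ σ (λ i e → sym (a i e)))) ⟩
        Pr (allSinks? S) * 𝔼 (λ σ → ind (strictly? N v σ) * 1ℚ)
          ≡⟨ cong (Pr (allSinks? S) *_) (ext 𝔼-linear λ σ → *-identityʳ (ind (strictly? N v σ))) ⟩
        Pr (allSinks? S) * R₀ v N ∎
        where
        N = closedNbhd S
        transfer : ∀ σ τ → Agree (mask S) false σ τ →
                   v ∉ N × v ∈ sinks σ × sinks σ ⊆ N ∪ ⁅ v ⁆ → v ∉ N × v ∈ sinks τ × sinks τ ⊆ N ∪ ⁅ v ⁆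
        transfer σ τ a (v∉ , v∈ , Z⊆) =
          v∉ , sinks-off-mask S σ τ a v∉ v∈ , within-mono S (p⊆p∪q ⁅ v ⁆) σ τ a Z⊆
        dominated : ∀ σ → ind (plus? S σ) ≤ ind (allSinks? S σ) * ind (strictly? N v σ) * resampleAvg (mask S) σ
            (λ _ → 1ℚ)
        dominated σ = ≤-trans
          (ind-mono (plus? S σ) (allSinks? S σ ×-dec strictly? N v σ) λ (v∉S , Z≡) →
              let S⊆Z : S ⊆ sinks σ
                  S⊆Z z∈ = subst (_ ∈_) (sym Z≡) (x∈p∪q⁺ (inj₁ z∈))
                  v∈Z : v ∈ sinks σ
                  v∈Z = subst (v ∈_) (sym Z≡) (x∈p∪q⁺ (inj₂ (x∈⁅x⁆ v)))
                  Z⊆ : sinks σ ⊆ N ∪ ⁅ v ⁆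
                  Z⊆ z∈ = [ (λ z∈S → x∈p∪q⁺ (inj₁ (⊆closedNbhd {S} z∈S))) , (λ z∈v → x∈p∪q⁺ (inj₂ z∈v)) ]′
                            (x∈p∪q⁻ S ⁅ v ⁆ (subst (_ ∈_) Z≡ z∈))
              in S⊆Z , (λ v∈N → v∉S (sinks∩nbhd σ S⊆Z v∈Z v∈N)) , v∈Z , Z⊆)
          (≤-reflexive (sym (trans (cong (ind (allSinks? S σ) * ind (strictly? N v σ) *_) (avg-const (mask S) σ 1ℚ))
                                   (trans (*-identityʳ _) (ind-× (allSinks? S σ) (strictly? N v σ))))))

    R-split : ∀ U v → R₀ v U + W v U ≤ R U v
    R-split U v = subst (_≤ R U v) (additive 𝔼-linear _ _) (monotone 𝔼-linear pointwise)
      where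
      pointwise : ∀ σ → ind (strictly? U v σ) + ind (sinkWithin? U v σ) ≤ ind (sinkBeyond? U v σ)
      pointwise σ = cases (v ∈? U)
        where
        cases : Dec (v ∈ U) → ind (strictly? U v σ) + ind (sinkWithin? U v σ) ≤ ind (sinkBeyond? U v σ)
        cases (yes v∈U) = ≤-trans (≤-reflexive (trans (cong (_+ ind (sinkWithin? U v σ))
            (ind-no (strictly? U v σ) λ (v∉U , _) → v∉U v∈U)) (+-identityˡ _)))
          (ind-mono (sinkWithin? U v σ) (sinkBeyond? U v σ) (λ (v∈ , Z⊆) → v∈ , λ z∈ → x∈p∪q⁺ (inj₁ (Z⊆ z∈))))
        cases (no v∉U) = ≤-trans (≤-reflexive (trans (cong (ind (strictly? U v σ) +_)
            (ind-no (sinkWithin? U v σ) (λ (v∈ , Z⊆) → v∉U (Z⊆ v∈)))) (+-identityʳ _)))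
          (ind-mono (strictly? U v σ) (sinkBeyond? U v σ) proj₂)

    -- Follows the recursion of `expectedFurtherDraws`, but charges a round 1 if it pops `v` and 0
    -- otherwise; the draws are recovered by weighting with degrees.
    visits : Fin n → ℕ → Orientation m → ℚ
    visits v zero    σ = 0ℚ
    visits v (suc r) σ =
      if hasSink E σ then ind (v ∈? sinks σ) + resampleAvg (resampleMask E σ) σ (visits v r) else 0ℚ

    visitsWithin : Fin n → ℕ → Subset n → ℚ
    visitsWithin v r U = 𝔼 λ σ → ind (within? U σ) * visits v r σ

    -- `W` counts a pop of `v` in the current round. If the popped set is `S`, the later rounds
    -- start from the law restricted to `closedNbhd S`, which is again of the form that
    -- `visitsWithin` treats.
    visitsWithin-suc : ∀ v r U → visitsWithin v (suc r) U ≡ W v U + layer (visitsWithin v r) U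
    visitsWithin-suc v r U = trans (ext 𝔼-linear split)
      (trans (additive 𝔼-linear _ _) (cong (W v U +_) (resample-layer U (visits v r))))
      where
      split : ∀ σ → ind (within? U σ) * visits v (suc r) σ
                  ≡ ind (sinkWithin? U v σ) + ind (first? U (sinks σ)) * resampleAvg (mask (sinks σ)) σ (visits v r)
      split σ = trans (cong (ind (within? U σ) *_) (cong₂ (λ b M → if b then ind (v ∈? sinks σ) + resampleAvg M σ
          (visits v r) else 0ℚ)
                                                         (hasSink⇔ σ) (resampleMask≡mask σ)))
                      (cases (nonempty? (sinks σ)))
        where
        A = resampleAvg (mask (sinks σ)) σ (visits v r)
        cases : (d : Dec (Nonempty (sinks σ))) → ind (within? U σ) * (if does d then ind (v ∈? sinks σ) + A else 0ℚ)
                                               ≡ ind (sinkWithin? U v σ) + ind (first? U (sinks σ)) * A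
        cases (no ¬∃) = trans (*-zeroʳ (ind (within? U σ))) (sym (cong₂ _+_
          (ind-no (sinkWithin? U v σ) (λ (v∈ , _) → ¬∃ (v , v∈)))
          (trans (cong (_* A) (ind-no (first? U (sinks σ)) (¬∃ ∘ proj₂))) (*-zeroˡ A))))
        cases (yes ne) = trans (*-distribˡ-+ (ind (within? U σ)) (ind (v ∈? sinks σ)) A) (cong₂ _+_
          (trans (*-comm (ind (within? U σ)) (ind (v ∈? sinks σ))) (ind-× (v ∈? sinks σ) (within? U σ)))
          (cong (_* A) (ind-cong (within? U σ) (first? U (sinks σ)) (λ Z⊆ → Z⊆ , ne) proj₁)))

    module _ (0<Q⊥ : 0ℚ < Q ⊥) where

      private
        0≤Q⊥ = <⇒≤ 0<Q⊥

        0<Q : ∀ U → 0ℚ < Q U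
        0<Q U = <-≤-trans 0<Q⊥ (Pr-mono (within? ⊥) (within? U) (λ σ Z⊆ z∈ → contradiction (Z⊆ z∈) ∉⊥))

      -- Maximum principle: at a set maximising the ratio R₀ / Q, the layer recursions of R₀ and Q bound that ratio by R ⊥ v / Q ⊥.
      Q⊥*R₀≤ : ∀ v U → Q ⊥ * R₀ v U ≤ R ⊥ v * Q U
      Q⊥*R₀≤ v U = begin
        Q ⊥ * R₀ v U      ≤⟨ *-monoʳ 0≤Q⊥ (R₀≤ U) ⟩
        Q ⊥ * (ρ * Q U)   ≡⟨ solve 3 (λ a b c → a :* (b :* c) := (b :* a) :* c) refl (Q ⊥) ρ (Q U) ⟩
        ρ * Q ⊥ * Q U     ≤⟨ *-monoˡ (0≤Pr (within? U)) ρ≤ ⟩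
        R ⊥ v * Q U       ∎
        where
        open ≤-Reasoning
        Q⁻¹ : Subset n → ℚ
        Q⁻¹ V = proj₁ (inverse (0<Q V))
        ratio : Subset n → ℚ
        ratio V = R₀ v V * Q⁻¹ V
        M = proj₁ (maximum ratio)
        ρ = ratio M
        ratio*Q : ∀ V → ratio V * Q V ≡ R₀ v V
        ratio*Q V = trans (*-assoc (R₀ v V) (Q⁻¹ V) (Q V)) (trans (cong (R₀ v V *_) (proj₂ (proj₂ (inverse (0<Q V)))))
            (*-identityʳ (R₀ v V)))
        R₀≤ : ∀ V → R₀ v V ≤ ρ * Q V
        R₀≤ V = subst (_≤ ρ * Q V) (ratio*Q V) (*-monoˡ (0≤Pr (within? V)) (proj₂ (maximum ratio) V))
        ρ≤ : ρ * Q ⊥ ≤ R ⊥ v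
        ρ≤ = +-cancelʳ-≤ (ρ * layer Q M) (begin
          ρ * Q ⊥ + ρ * layer Q M ≡⟨ trans (sym (*-distribˡ-+ ρ (Q ⊥) (layer Q M))) (cong (ρ *_) (sym (Q-layer M))) ⟩
          ρ * Q M                 ≡⟨ ratio*Q M ⟩
          R₀ v M                  ≤⟨ Pr-mono (strictly? M v) (sinkBeyond? M v) (λ σ → proj₂) ⟩
          R M v                   ≤⟨ R-layer M v ⟩
          R ⊥ v + layer (R₀ v) M  ≤⟨ +-monoʳ-≤ (R ⊥ v) (monotone (layer-linear M) R₀≤) ⟩
          R ⊥ v + layer (λ V → ρ * Q V) M ≡⟨ cong (R ⊥ v +_) (homogeneous (layer-linear M) ρ Q) ⟩
          R ⊥ v + ρ * layer Q M ∎)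

      -- The summand `R₀` is what makes the induction on `r` close. A round adds `W`, and
      -- `R₀ + W ≤ R ≤ R ⊥ v + layer R₀`, so the left side is at most `Q ⊥ * R ⊥ v` plus the layer
      -- of the previous left side. The hypothesis turns this into `R ⊥ v` times `Q ⊥ + layer Q`,
      -- and that sum is `Q U`.
      visitsWithin-bound : ∀ v r U → Q ⊥ * (visitsWithin v r U + R₀ v U) ≤ R ⊥ v * Q U
      visitsWithin-bound v zero U = subst (λ z → Q ⊥ * z ≤ R ⊥ v * Q U)
        (sym (trans (cong (_+ R₀ v U) (trans (ext 𝔼-linear λ σ → *-zeroʳ (ind (within? U σ))) (zeroed 𝔼-linear)))
            (+-identityˡ (R₀ v U))))
        (Q⊥*R₀≤ v U)
      visitsWithin-bound v (suc r) U = begin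
        Q ⊥ * (visitsWithin v (suc r) U + R₀ v U) ≡⟨ cong (λ z → Q ⊥ * (z + R₀ v U)) (visitsWithin-suc v r U) ⟩
        Q ⊥ * (W v U + LG + R₀ v U)       ≡⟨ cong (Q ⊥ *_) (solve 3 (λ a b c → a :+ b :+ c := (c :+ a) :+ b) refl
            (W v U) LG (R₀ v U)) ⟩
        Q ⊥ * (R₀ v U + W v U + LG)       ≤⟨ *-monoʳ 0≤Q⊥ (+-monoˡ-≤ LG (≤-trans (R-split U v) (R-layer U v))) ⟩
        Q ⊥ * (R ⊥ v + layer (R₀ v) U + LG) ≡⟨ solve 4 (λ q a b c → q :* (a :+ b :+ c) := a :* q :+ q :* (c :+ b))
            refl (Q ⊥) (R ⊥ v) (layer (R₀ v) U) LG ⟩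
        R ⊥ v * Q ⊥ + Q ⊥ * (LG + layer (R₀ v) U)
          ≡⟨ cong (R ⊥ v * Q ⊥ +_) (sym (trans (homogeneous (layer-linear U) (Q ⊥)
              (λ V → visitsWithin v r V + R₀ v V)) (cong (Q ⊥ *_)
                  (additive (layer-linear U) (visitsWithin v r) (R₀ v))))) ⟩
        R ⊥ v * Q ⊥ + layer (λ V → Q ⊥ * (visitsWithin v r V + R₀ v V)) U
          ≤⟨ +-monoʳ-≤ (R ⊥ v * Q ⊥) (monotone (layer-linear U) (visitsWithin-bound v r)) ⟩
        R ⊥ v * Q ⊥ + layer (λ V → R ⊥ v * Q V) U ≡⟨ cong (R ⊥ v * Q ⊥ +_) (homogeneous (layer-linear U) (R ⊥ v) Q) ⟩
        R ⊥ v * Q ⊥ + R ⊥ v * layer Q U   ≡⟨ trans (sym (*-distribˡ-+ (R ⊥ v) (Q ⊥) (layer Q U)))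
            (cong (R ⊥ v *_) (sym (Q-layer U))) ⟩
        R ⊥ v * Q U ∎
        where
        open ≤-Reasoning
        LG = layer (visitsWithin v r) U

      expectedVisits≤ : ∀ v r → Q ⊥ * 𝔼 (visits v r) ≤ R ⊥ v
      expectedVisits≤ v r = begin
        Q ⊥ * 𝔼 (visits v r) ≡⟨ cong (Q ⊥ *_) (ext 𝔼-linear λ σ → sym
            (trans (cong (_* visits v r σ) (ind-yes (within? ⊤ σ) ⊆⊤)) (*-identityˡ (visits v r σ)))) ⟩
        Q ⊥ * visitsWithin v r ⊤ ≤⟨ *-monoʳ 0≤Q⊥ (p≤p+q (0≤Pr (strictly? ⊤ v))) ⟩
        Q ⊥ * (visitsWithin v r ⊤ + R₀ v ⊤) ≤⟨ visitsWithin-bound v r ⊤ ⟩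
        R ⊥ v * Q ⊤ ≤⟨ *-monoʳ (0≤Pr (sinkBeyond? ⊥ v)) (≤-trans (monotone 𝔼-linear λ σ → ind≤1 (within? ⊤ σ))
            (≤-reflexive (avg-const (replicate m true) (replicate m false) 1ℚ))) ⟩
        R ⊥ v * 1ℚ ≡⟨ *-identityʳ (R ⊥ v) ⟩
        R ⊥ v ∎
        where open ≤-Reasoning

  -- Naturals as rationals, subset sizes, flipping one bit.

  ℕ→ℚ-suc : ∀ a → ℕ→ℚ (suc a) ≡ 1ℚ + ℕ→ℚ a
  ℕ→ℚ-suc a = toℚᵘ-injective (begin
    toℚᵘ (ℕ→ℚ (suc a))              ≈⟨ toℚᵘ-fromℚᵘ (ℚᵘ.mkℚᵘ (ℤ.+ suc a) 0) ⟩
    ℚᵘ.mkℚᵘ (ℤ.+ suc a) 0           ≈⟨ ℚᵘ.*≡* (cong (λ z → (ℤ.+ 1 ℤ.+ z) ℤ.* ℤ.+ 1) (sym (ℤ.*-identityʳ (ℤ.+ a)))) ⟩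
    ℚᵘ.1ℚᵘ ℚᵘ.+ ℚᵘ.mkℚᵘ (ℤ.+ a) 0   ≈⟨ ℚᵘ.+-congʳ ℚᵘ.1ℚᵘ (ℚᵘ.≃-sym (toℚᵘ-fromℚᵘ (ℚᵘ.mkℚᵘ (ℤ.+ a) 0))) ⟩
    ℚᵘ.1ℚᵘ ℚᵘ.+ toℚᵘ (ℕ→ℚ a)        ≈⟨ ℚᵘ.≃-sym (toℚᵘ-homo-+ 1ℚ (ℕ→ℚ a)) ⟩
    toℚᵘ (1ℚ + ℕ→ℚ a)               ∎)
    where open ℚᵘ.≃-Reasoning

  ℕ→ℚ-+ : ∀ a b → ℕ→ℚ (a ℕ.+ b) ≡ ℕ→ℚ a + ℕ→ℚ b
  ℕ→ℚ-+ zero    b = sym (+-identityˡ (ℕ→ℚ b))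
  ℕ→ℚ-+ (suc a) b = begin
    ℕ→ℚ (suc (a ℕ.+ b))     ≡⟨ ℕ→ℚ-suc (a ℕ.+ b) ⟩
    1ℚ + ℕ→ℚ (a ℕ.+ b)      ≡⟨ cong (1ℚ +_) (ℕ→ℚ-+ a b) ⟩
    1ℚ + (ℕ→ℚ a + ℕ→ℚ b)    ≡⟨ sym (+-assoc 1ℚ (ℕ→ℚ a) (ℕ→ℚ b)) ⟩
    1ℚ + ℕ→ℚ a + ℕ→ℚ b      ≡⟨ cong (_+ ℕ→ℚ b) (sym (ℕ→ℚ-suc a)) ⟩
    ℕ→ℚ (suc a) + ℕ→ℚ b     ∎
    where open ≡-Reasoning

  ℕ→ℚ-* : ∀ a b → ℕ→ℚ (a ℕ.* b) ≡ ℕ→ℚ a * ℕ→ℚ b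
  ℕ→ℚ-* zero    b = sym (*-zeroˡ (ℕ→ℚ b))
  ℕ→ℚ-* (suc a) b = begin
    ℕ→ℚ (b ℕ.+ a ℕ.* b)               ≡⟨ ℕ→ℚ-+ b (a ℕ.* b) ⟩
    ℕ→ℚ b + ℕ→ℚ (a ℕ.* b)             ≡⟨ cong₂ _+_ (sym (*-identityˡ (ℕ→ℚ b))) (ℕ→ℚ-* a b) ⟩
    1ℚ * ℕ→ℚ b + ℕ→ℚ a * ℕ→ℚ b        ≡⟨ sym (*-distribʳ-+ (ℕ→ℚ b) 1ℚ (ℕ→ℚ a)) ⟩
    (1ℚ + ℕ→ℚ a) * ℕ→ℚ b              ≡⟨ cong (_* ℕ→ℚ b) (sym (ℕ→ℚ-suc a)) ⟩
    ℕ→ℚ (suc a) * ℕ→ℚ b               ∎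
    where open ≡-Reasoning

  0≤ℕ→ℚ : ∀ a → 0ℚ ≤ ℕ→ℚ a
  0≤ℕ→ℚ zero    = ≤-refl
  0≤ℕ→ℚ (suc a) = subst (0ℚ ≤_) (sym (ℕ→ℚ-suc a)) (0≤+ 0≤1 (0≤ℕ→ℚ a))

  suc-* : ∀ a q → ℕ→ℚ (suc a) * q ≡ q + ℕ→ℚ a * q
  suc-* a q = trans (cong (_* q) (ℕ→ℚ-suc a)) (trans (*-distribʳ-+ q 1ℚ (ℕ→ℚ a)) (cong (_+ ℕ→ℚ a * q) (*-identityˡ q)))

  q≤suc*q : ∀ a {q} → 0ℚ ≤ q → q ≤ ℕ→ℚ (suc a) * q
  q≤suc*q a {q} 0≤q = subst (q ≤_) (sym (suc-* a q)) (p≤p+q (0≤* (0≤ℕ→ℚ a) 0≤q))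

  size-remove : ∀ {p : Subset k} {x} → x ∈ p → ∣ p ∣ ≡ suc ∣ p - x ∣
  size-remove {p = true ∷ p} {zero} _ = cong (suc ∘ ∣_∣) (sym (p─⊥≡p p))
  size-remove {p = true ∷ p} {suc x} (Data.Vec.there x∈) = cong suc (size-remove x∈)
  size-remove {p = false ∷ p} {suc x} (Data.Vec.there x∈) = size-remove x∈

  ∑-size : ∀ (p : Subset k) → ∑ (λ x → ind (x ∈? p)) ≡ ℕ→ℚ ∣ p ∣
  ∑-size [] = refl
  ∑-size {suc k} (true ∷ p) = trans (cong (1ℚ +_) (trans (ext (∑-linear {k}) λ x → ind-cong (suc x ∈? true ∷ p)
      (x ∈? p) drop-there Data.Vec.there) (∑-size p))) (sym (ℕ→ℚ-suc ∣ p ∣))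
  ∑-size {suc k} (false ∷ p) = trans (+-identityˡ _) (trans (ext (∑-linear {k}) λ x → ind-cong (suc x ∈? false ∷ p)
      (x ∈? p) drop-there Data.Vec.there) (∑-size p))

  flip : Fin k → Vec Bool k → Vec Bool k
  flip i σ = updateAt σ i not

  uniformAvg-flip : ∀ (i : Fin k) F → uniformAvg k (F ∘ flip i) ≡ uniformAvg k F
  uniformAvg-flip {suc k} zero    F = cong (½ *_) (+-comm (uniformAvg k (F ∘ (false ∷_)))
      (uniformAvg k (F ∘ (true ∷_))))
  uniformAvg-flip {suc k} (suc i) F = cong (½ *_) (cong₂ _+_ (uniformAvg-flip i (F ∘ (true ∷_)))
      (uniformAvg-flip i (F ∘ (false ∷_))))

  -- Edge reversals and the repair of sinks along a path.

  module Flipping {n m : ℕ} (E : Fin m → Fin n × Fin n) (simple : SimpleGraph n m E) where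
    open Sinks E
    open Popping E

    Joins : Fin m → Fin n → Fin n → Set
    Joins i a b = E i ≡ (a , b) ⊎ E i ≡ (b , a)

    joins? : ∀ i a b → Dec (Joins i a b)
    joins? i a b = ≟× (E i) (a , b) ⊎-dec ≟× (E i) (b , a)
      where
      ≟× = ≡-dec Fin._≟_ Fin._≟_

    Joins-sym : ∀ {i a b} → Joins i a b → Joins i b a
    Joins-sym = [ inj₂ , inj₁ ]′

    Joins-touchesˡ : ∀ {i a b} → Joins i a b → Touches i a
    Joins-touchesˡ (inj₁ e) = inj₁ (cong proj₁ e)
    Joins-touchesˡ (inj₂ e) = inj₂ (cong proj₂ e)

    no-loop : ∀ {i a b} → Joins i a b → a ≢ b
    no-loop {i} (inj₁ e) refl = ℕ.<-irrefl refl (subst (λ (s , t) → Data.Fin.toℕ s ℕ.< Data.Fin.toℕ t) e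
        (proj₁ simple i))
    no-loop {i} (inj₂ e) refl = ℕ.<-irrefl refl (subst (λ (s , t) → Data.Fin.toℕ s ℕ.< Data.Fin.toℕ t) e
        (proj₁ simple i))

    edge-unique : ∀ {i j a b} → Joins i a b → Joins j a b → i ≡ j
    edge-unique {i} {j} (inj₁ e) (inj₁ f) = proj₂ simple (trans e (sym f))
    edge-unique {i} {j} (inj₂ e) (inj₂ f) = proj₂ simple (trans e (sym f))
    edge-unique {i} {j} (inj₁ e) (inj₂ f) = contradiction
      (subst (λ (s , t) → Data.Fin.toℕ s ℕ.< Data.Fin.toℕ t) f (proj₁ simple j))
      (ℕ.<-asym (subst (λ (s , t) → Data.Fin.toℕ s ℕ.< Data.Fin.toℕ t) e (proj₁ simple i)))
    edge-unique {i} {j} (inj₂ e) (inj₁ f) = sym (edge-unique {j} {i} (inj₁ f) (inj₂ e))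

    touches-end : ∀ {i a b z} → Joins i a b → Touches i z → z ≡ a ⊎ z ≡ b
    touches-end (inj₁ e) (inj₁ t) = inj₁ (trans (sym t) (cong proj₁ e))
    touches-end (inj₁ e) (inj₂ t) = inj₂ (trans (sym t) (cong proj₂ e))
    touches-end (inj₂ e) (inj₁ t) = inj₂ (trans (sym t) (cong proj₁ e))
    touches-end (inj₂ e) (inj₂ t) = inj₁ (trans (sym t) (cong proj₂ e))

    other-end : ∀ {i a b c} → Joins i a b → Joins i a c → b ≡ c
    other-end {i} {a} {b} {c} p q with touches-end p (Joins-touchesˡ {i} {c} {a} (Joins-sym {i} {a} {c} q))
    ... | inj₁ c≡a = contradiction (sym c≡a) (no-loop q)
    ... | inj₂ c≡b = sym c≡b

    tail-end : ∀ σ {i a b} → Joins i a b → tail σ i ≡ a ⊎ tail σ i ≡ b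
    tail-end σ {i} j = touches-end {i} j (tail-touches σ i refl)

    tail-flip : ∀ σ {i a b} → Joins i a b → tail σ i ≡ b → tail (flip i σ) i ≡ a
    tail-flip σ {i} j eq rewrite lookup∘updateAt i {not} σ with lookup σ i | j
    ... | true  | inj₁ refl = sym eq
    ... | true  | inj₂ refl = refl
    ... | false | inj₁ refl = refl
    ... | false | inj₂ refl = sym eq

    tail-flip-other : ∀ σ {i j} → j ≢ i → tail (flip i σ) j ≡ tail σ j
    tail-flip-other σ {i} {j} j≢i = cong (tailOf (E j)) (lookup∘updateAt′ j i j≢i σ)

    sinks-flip : ∀ σ i {z} → z ∈ sinks (flip i σ) → z ≡ tail σ i ⊎ z ∈ sinks σ
    sinks-flip σ i {z} z∈ with z Fin.≟ tail σ i
    ... | yes eq = inj₁ eq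
    ... | no z≢ = inj₂ (∈sinks⁺ σ λ j eq → old j eq (j Fin.≟ i))
      where
      old : ∀ j → tail σ j ≡ z → ¬ Dec (j ≡ i)
      old j eq (yes refl) = z≢ (sym eq)
      old j eq (no j≢i)   = ∈sinks⁻ (flip i σ) z∈ j (trans (tail-flip-other σ j≢i) eq)

    𝔼-flip : ∀ i F → 𝔼 (F ∘ flip i) ≡ 𝔼 F
    𝔼-flip i F = uniformAvg-flip i F

    ∈-insert : ∀ {k} (U : Subset k) {w z} → z ∈ U ∪ ⁅ w ⁆ → z ∈ U ⊎ z ≡ w
    ∈-insert U {w} z∈ = [ inj₁ , inj₂ ∘ x∈⁅y⁆⇒x≡y w ]′ (x∈p∪q⁻ U ⁅ w ⁆ z∈)

    insert-∈ : ∀ {k} (U : Subset k) {w z} → z ∈ U ⊎ z ≡ w → z ∈ U ∪ ⁅ w ⁆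
    insert-∈ U (inj₁ z∈)   = x∈p∪q⁺ (inj₁ z∈)
    insert-∈ U (inj₂ refl) = x∈p∪q⁺ (inj₂ (x∈⁅x⁆ _))

    drop-nonsink : ∀ U {w} σ → w ∉ sinks σ → sinks σ ⊆ U ∪ ⁅ w ⁆ → sinks σ ⊆ U
    drop-nonsink U σ w∉ Z⊆ z∈ with ∈-insert U (Z⊆ z∈)
    ... | inj₁ z∈U  = z∈U
    ... | inj₂ refl = contradiction z∈ w∉

    -- Reversing an edge ab whose tail is b can only make b a new sink, and it cures a.
    within-flip : ∀ U σ {i a b} → Joins i a b → tail σ i ≡ b → sinks σ ⊆ U ∪ ⁅ a ⁆ → sinks (flip i σ) ⊆ U ∪ ⁅ b ⁆
    within-flip U σ {i} {a} {b} j eq Z⊆ {z} z∈ with sinks-flip σ i z∈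
    ... | inj₁ z≡ = insert-∈ U (inj₂ (trans z≡ eq))
    ... | inj₂ z∈σ with ∈-insert U (Z⊆ z∈σ)
    ... | inj₁ z∈U  = insert-∈ U (inj₁ z∈U)
    ... | inj₂ refl = contradiction z∈ (out⇒∉sinks (flip i σ) (tail-flip σ j eq))

    Q-insert : ∀ U v → Q (U ∪ ⁅ v ⁆) ≤ Q U + R U v
    Q-insert U v = subst (Q (U ∪ ⁅ v ⁆) ≤_) (additive 𝔼-linear _ _) (monotone 𝔼-linear λ σ →
      ind-⊎ (within? (U ∪ ⁅ v ⁆) σ) (within? U σ) (sinkBeyond? U v σ) (split σ))
      where
      split : ∀ σ → sinks σ ⊆ U ∪ ⁅ v ⁆ → sinks σ ⊆ U ⊎ (v ∈ sinks σ × sinks σ ⊆ U ∪ ⁅ v ⁆)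
      split σ Z⊆ with v ∈? sinks σ
      ... | yes v∈ = inj₂ (v∈ , Z⊆)
      ... | no v∉  = inj₁ (drop-nonsink U σ v∉ Z⊆)

    R-neighbour : ∀ U {i u v} → Joins i u v → R U u ≤ Q U + R U v
    R-neighbour U {i} {u} {v} j = ≤-trans (monotone 𝔼-linear pointwise)
      (≤-trans (≤-reflexive (𝔼-flip i (λ σ → ind (within? (U ∪ ⁅ v ⁆) σ)))) (Q-insert U v))
      where
      pointwise : ∀ σ → ind (sinkBeyond? U u σ) ≤ ind (within? (U ∪ ⁅ v ⁆) (flip i σ))
      pointwise σ = ind-mono (sinkBeyond? U u σ) (within? (U ∪ ⁅ v ⁆) (flip i σ)) λ (u∈ , Z⊆) →
        within-flip U σ j ([ (λ eq → contradiction u∈ (out⇒∉sinks σ eq)) , (λ eq → eq) ]′ (tail-end σ j)) Z⊆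

    OnlyOut : Fin m → Fin n → Orientation m → Set
    OnlyOut i v σ = tail σ i ≡ v × (∀ j → tail σ j ≡ v → j ≡ i)

    onlyOut? : ∀ i v σ → Dec (OnlyOut i v σ)
    onlyOut? i v σ = (tail σ i Fin.≟ v) ×-dec Fin.all? λ j → (tail σ j Fin.≟ v) →-dec (j Fin.≟ i)

    onlyOutWithin? : ∀ U i v σ → Dec (OnlyOut i v σ × sinks σ ⊆ U)
    onlyOutWithin? U i v σ = onlyOut? i v σ ×-dec within? U σ

    -- Inner degree at least 2, in the form a path needs: whatever edge `i` it arrived by, there is
    -- another one to leave by.
    ExitsIn : Subset n → Set
    ExitsIn A = ∀ {a} → a ∈ A → ∀ i → ∃ λ j → j ≢ i × ∃ λ b → b ∈ A × Joins j a b

    module Chains (U A : Subset n) (exits : ExitsIn A) {i₀ v x}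
                  (x-out : ∀ σ → OnlyOut i₀ v σ → x ∉ sinks σ) where

      target : ℚ
      target = Pr (onlyOutWithin? U i₀ v)

      0≤target : 0ℚ ≤ target
      0≤target = 0≤Pr (onlyOutWithin? U i₀ v)

      -- A path from v through visited to its current end w.  Λ fixes the edges at v, with i₀ the only one leaving v, and
      -- orients the path towards w, so that only w can become a sink.  The second neighbour x of v is never a sink under Λ:
      -- reaching it ends the path, which is what lowers the factor from ∣ A ∣ to ∣ A ∣ - 1.
      record Chain (w : Fin n) : Set₁ where
        field
          Λ       : Orientation m → Set
          Λ?      : ∀ σ → Dec (Λ σ)
          locked  : Subset m
          visited : Subset n
          fresh   : Subset n
          entry   : Fin m
          Λ⇒only  : ∀ σ → Λ σ → OnlyOut i₀ v σ
          unlocked : ∀ σ {i} → i ∉ locked → Λ σ → Λ (flip i σ)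
          visited-out : ∀ {b} → b ∈ visited → ∃ λ i → i ∈ locked × (∀ σ → Λ σ → tail σ i ≡ b)
          -- At an unvisited vertex a locked edge is either an edge to `v` other than `i₀`, hence
          -- directed towards `v`, or the edge by which the path reached `w`.
          locked-out  : ∀ {z i} → z ∉ visited → i ∈ locked → Touches i z →
                        (∀ σ → Λ σ → tail σ i ≡ z) ⊎ (z ≡ w × i ≡ entry)
          cover   : ∀ {y} → y ∈ A → y ∈ visited ⊎ y ≡ w ⊎ y ∈ fresh
          w∈A     : w ∈ A
          w-unvisited : w ∉ visited
          x∈fresh : x ∈ fresh

        state? : ∀ σ → Dec (Λ σ × sinks σ ⊆ U ∪ ⁅ w ⁆)
        state? σ = Λ? σ ×-dec within? (U ∪ ⁅ w ⁆) σ

      open Chain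

      to-target : ∀ {w} (C : Chain w) → (∀ σ → Λ C σ → w ∉ sinks σ) → Pr (state? C) ≤ target
      to-target C out = Pr-mono (state? C) (onlyOutWithin? U i₀ v) λ σ (λσ , Z⊆) →
        Λ⇒only C σ λσ , drop-nonsink U σ (out σ λσ) Z⊆

      -- Look at one edge `j` at the only possible new sink `w`. If `j` leaves `w`, the orientation
      -- is already in the target event. If not, reversing `j` cures `w` and preserves the uniform
      -- law, and what remains to be bounded is the event reached by the reversal.
      branch : ∀ {w j y} (C : Chain w) → Joins j w y → {P : Orientation m → Set} (P? : ∀ σ → Dec (P σ)) →
               (∀ σ → Λ C σ → sinks σ ⊆ U ∪ ⁅ w ⁆ → tail σ j ≡ y → P (flip j σ)) →
               Pr (state? C) ≤ target + Pr P?
      branch {w} {j} {y} C join {P} P? after = ≤-trans (monotone 𝔼-linear pointwise)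
        (≤-reflexive (trans (additive 𝔼-linear _ _) (cong (target +_) (𝔼-flip j (λ σ → ind (P? σ))))))
        where
        pointwise : ∀ σ → ind (state? C σ) ≤ ind (onlyOutWithin? U i₀ v σ) + ind (P? (flip j σ))
        pointwise σ = ind-⊎ (state? C σ) (onlyOutWithin? U i₀ v σ) (P? (flip j σ)) split
          where
          split : Λ C σ × sinks σ ⊆ U ∪ ⁅ w ⁆ → (OnlyOut i₀ v σ × sinks σ ⊆ U) ⊎ P (flip j σ)
          split (λσ , Z⊆) with tail-end σ join
          ... | inj₁ eq = inj₁ (Λ⇒only C σ λσ , drop-nonsink U σ (out⇒∉sinks σ eq) Z⊆)
          ... | inj₂ eq = inj₂ (after σ λσ Z⊆ eq)

      -- After the reversal `j` leaves `w`; locking it ensures that `w` stays cured. Each extension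
      -- removes its new end from `fresh`, and `y ≢ x` keeps `x` there.
      extend : ∀ {w j y} (C : Chain w) → Joins j w y → y ∈ A → y ∉ visited C → y ≢ x → Chain y
      extend {w} {j} {y} C join y∈A y∉V y≢x = record
        { Λ       = λ σ → Λ C σ × tail σ j ≡ w
        ; Λ?      = λ σ → Λ? C σ ×-dec (tail σ j Fin.≟ w)
        ; locked  = locked C ∪ ⁅ j ⁆
        ; visited = visited C ∪ ⁅ w ⁆
        ; fresh   = fresh C - y
        ; entry   = j
        ; Λ⇒only  = λ σ (λσ , _) → Λ⇒only C σ λσ
        ; unlocked = λ σ i∉ (λσ , eq) → unlocked C σ (i∉ ∘ x∈p∪q⁺ ∘ inj₁) λσ
                                      , trans (tail-flip-other σ λ { refl → i∉ (x∈p∪q⁺ (inj₂ (x∈⁅x⁆ j))) }) eq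
        ; visited-out = vo
        ; locked-out  = lo
        ; cover   = cov
        ; w∈A     = y∈A
        ; w-unvisited = y∉
        ; x∈fresh = x∈p∧x≢y⇒x∈p-y (x∈fresh C) (y≢x ∘ sym)
        }
        where
        vo : ∀ {b} → b ∈ visited C ∪ ⁅ w ⁆ → ∃ λ i → i ∈ locked C ∪ ⁅ j ⁆ × (∀ σ → Λ C σ × tail σ j ≡ w → tail σ i ≡ b)
        vo b∈ with ∈-insert (visited C) b∈
        ... | inj₁ b∈V = let i , i∈ , out = visited-out C b∈V in i , x∈p∪q⁺ (inj₁ i∈) , λ σ (λσ , _) → out σ λσ
        ... | inj₂ refl = j , x∈p∪q⁺ (inj₂ (x∈⁅x⁆ j)) , λ σ → proj₂
        y∉ : y ∉ visited C ∪ ⁅ w ⁆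
        y∉ y∈ with ∈-insert (visited C) y∈
        ... | inj₁ y∈V  = y∉V y∈V
        ... | inj₂ refl = no-loop join refl
        lo : ∀ {z i} → z ∉ visited C ∪ ⁅ w ⁆ → i ∈ locked C ∪ ⁅ j ⁆ → Touches i z →
             (∀ σ → Λ C σ × tail σ j ≡ w → tail σ i ≡ z) ⊎ (z ≡ y × i ≡ j)
        lo z∉ i∈ t with ∈-insert (locked C) i∈
        lo z∉ i∈ t | inj₁ i∈L with locked-out C (z∉ ∘ x∈p∪q⁺ ∘ inj₁) i∈L t
        ... | inj₁ out = inj₁ λ σ (λσ , _) → out σ λσ
        ... | inj₂ (refl , _) = contradiction (x∈p∪q⁺ (inj₂ (x∈⁅x⁆ w))) z∉
        lo z∉ i∈ t | inj₂ refl with touches-end join t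
        ... | inj₁ refl = contradiction (x∈p∪q⁺ (inj₂ (x∈⁅x⁆ w))) z∉
        ... | inj₂ z≡y  = inj₂ (z≡y , refl)
        cov : ∀ {z} → z ∈ A → z ∈ visited C ∪ ⁅ w ⁆ ⊎ z ≡ y ⊎ z ∈ fresh C - y
        cov {z} z∈A with cover C z∈A | z Fin.≟ y
        ... | inj₁ z∈V         | _      = inj₁ (x∈p∪q⁺ (inj₁ z∈V))
        ... | inj₂ (inj₁ refl) | _      = inj₁ (x∈p∪q⁺ (inj₂ (x∈⁅x⁆ w)))
        ... | inj₂ (inj₂ z∈F)  | yes eq = inj₂ (inj₁ eq)
        ... | inj₂ (inj₂ z∈F)  | no z≢y = inj₂ (inj₂ (x∈p∧x≢y⇒x∈p-y z∈F z≢y))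

      once-more : ∀ {c q k} → c ≤ target + q → q ≤ ℕ→ℚ k * target → c ≤ ℕ→ℚ (suc k) * target
      once-more {k = k} c≤ q≤ = ≤-trans c≤ (≤-trans (+-monoʳ-≤ target q≤) (≤-reflexive (sym (suc-* k target))))

      -- Leave `w` by an edge other than the entry. If that edge is locked, or leads to a visited
      -- vertex or to `x`, the path ends, costing at most two copies of `target`. Otherwise it is
      -- extended at the price of one copy and one fresh vertex. As `fresh` still contains `x` when
      -- the path ends, the total is at most the initial size of `fresh` plus 1.
      chain-bound : ∀ k {w} (C : Chain w) → ∣ fresh C ∣ ℕ.≤ k → Pr (state? C) ≤ ℕ→ℚ (suc k) * target
      -- `x` always stays in `fresh`, so the size bound is never 0.
      chain-bound zero C small = contradiction (ℕ.≤-trans (ℕ.≤-reflexive (sym (size-remove (x∈fresh C)))) small) λ ()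
      chain-bound (suc k) {w} C small with exits (w∈A C) (entry C)
      ... | j , j≢entry , y , y∈A , join with j ∈? locked C
      ... | yes j∈L with locked-out C (w-unvisited C) j∈L (Joins-touchesˡ join)
      ... | inj₂ (_ , j≡entry) = contradiction j≡entry j≢entry
      -- A locked edge other than the entry already leaves `w`, so `w` was never a sink and nothing
      -- needs reversing.
      ... | inj₁ out = ≤-trans (to-target C λ σ λσ → out⇒∉sinks σ (out σ λσ)) (q≤suc*q (suc k) 0≤target)
      chain-bound (suc k) {w} C small | j , j≢entry , y , y∈A , join | no j∉L with y ∈? visited C
      -- `y` keeps its locked outgoing edge when `j` is reversed, so no new sink arises.
      ... | yes y∈V = once-more {k = suc k} (branch C join (onlyOutWithin? U i₀ v) λ σ λσ Z⊆ eq →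
                        let i , _ , out = visited-out C y∈V
                            λ′ = unlocked C σ j∉L λσ
                        in Λ⇒only C (flip j σ) λ′ ,
                           drop-nonsink U (flip j σ) (out⇒∉sinks (flip j σ) (out (flip j σ) λ′))
                               (within-flip U σ join eq Z⊆))
                      (q≤suc*q k 0≤target)
      ... | no y∉V with y Fin.≟ x
      ... | yes refl = once-more {k = suc k} (branch C join (onlyOutWithin? U i₀ v) λ σ λσ Z⊆ eq →
                        let only = Λ⇒only C (flip j σ) (unlocked C σ j∉L λσ)
                        in only , drop-nonsink U (flip j σ) (x-out (flip j σ) only) (within-flip U σ join eq Z⊆))
                      (q≤suc*q k 0≤target)
      ... | no y≢x with cover C y∈A
      ... | inj₁ y∈V        = contradiction y∈V y∉V
      ... | inj₂ (inj₁ y≡w) = contradiction (sym y≡w) (no-loop join)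
      ... | inj₂ (inj₂ y∈F) = once-more {k = suc k} (branch C join (state? C′) λ σ λσ Z⊆ eq →
                        (unlocked C σ j∉L λσ , tail-flip σ join eq) , within-flip U σ join eq Z⊆)
                      (chain-bound k C′ (ℕ.≤-pred (ℕ.≤-trans (ℕ.≤-reflexive (sym (size-remove y∈F))) small)))
        where C′ = extend C join y∈A y∉V y≢x

    -- Reversing `i` at the sink `v` makes it the only edge leaving `v`, and only `u` can become a
    -- new sink: this starts a chain at `u`. Its fresh vertices are those of `A` other than `v` and
    -- `u`, so `chain-bound` gives the factor `∣ A ∣ - 2 + 1`.
    R-bound : ∀ U A → ExitsIn A → ∀ {i v u} → v ∈ A → u ∈ A → Joins i v u →
              ∀ b → ∣ A ∣ ≡ suc b → R U v ≤ ℕ→ℚ b * Pr (onlyOutWithin? U i v)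
    R-bound U A exits {i₀} {v} {u} v∈A u∈A join b size with exits v∈A i₀
    ... | j , j≢i₀ , x , x∈A , join′ = subst (λ b → R U v ≤ ℕ→ℚ b * target) (ℕ.suc-injective size′)
        (≤-trans start (chain-bound ∣ A - v - u ∣ C ℕ.≤-refl))
      where
      v≢u = no-loop join
      u∈A-v = x∈p∧x≢y⇒x∈p-y u∈A (v≢u ∘ sym)
      x≢u : x ≢ u
      x≢u refl = j≢i₀ (edge-unique join′ join)
      -- The edge `j` from `v` to `x` is not `i₀`; if `i₀` alone leaves `v`, then `j` must leave
      -- `x`.
      x-out : ∀ σ → OnlyOut i₀ v σ → x ∉ sinks σ
      x-out σ (_ , only) = [ (λ eq → contradiction (only j eq) j≢i₀) , out⇒∉sinks σ ]′ (tail-end σ join′)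
      open Chains U A exits x-out
      size′ : suc (suc ∣ A - v - u ∣) ≡ suc b
      size′ = trans (cong suc (sym (size-remove u∈A-v))) (trans (sym (size-remove v∈A)) size)
      L? : ∀ i → Dec (Touches i v)
      L? i = touches? i v
      C : Chain u
      C = record
        { Λ       = OnlyOut i₀ v
        ; Λ?      = onlyOut? i₀ v
        -- Whether `i₀` is the only edge leaving `v` depends on every edge at `v`, so all of them
        -- are locked.
        ; locked  = ⟦ L? ⟧
        ; visited = ⁅ v ⁆
        ; fresh   = A - v - u
        ; entry   = i₀
        ; Λ⇒only  = λ σ o → o
        ; unlocked = λ σ {i} i∉ (out , only) →
            trans (tail-flip-other σ λ { refl → i∉ (∈⟦⟧⁺ L? (Joins-touchesˡ join)) }) out ,
            λ k eq → only k (trans (sym (tail-flip-other σ λ { refl → i∉ (∈⟦⟧⁺ L? (tail-touches (flip k σ) k eq)) }))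
                eq)
        ; visited-out = λ b∈ → i₀ , ∈⟦⟧⁺ L? (Joins-touchesˡ join) , λ σ (out , _) → trans out (sym (x∈⁅y⁆⇒x≡y v b∈))
        ; locked-out  = λ z∉ i∈ t → lo z∉ (∈⟦⟧⁻ L? i∈) t
        ; cover   = cov
        ; w∈A     = u∈A
        ; w-unvisited = v≢u ∘ sym ∘ x∈⁅y⁆⇒x≡y v
        ; x∈fresh = x∈p∧x≢y⇒x∈p-y (x∈p∧x≢y⇒x∈p-y x∈A (no-loop join′ ∘ sym)) x≢u
        }
        where
        lo : ∀ {z i} → z ∉ ⁅ v ⁆ → Touches i v → Touches i z → (∀ σ → OnlyOut i₀ v σ → tail σ i ≡ z) ⊎ (z ≡ u × i ≡ i₀)
        lo {z} {i} z∉ t t′ with i Fin.≟ i₀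
        ... | yes refl = [ (λ { refl → contradiction (x∈⁅x⁆ v) z∉ }) , (λ z≡u → inj₂ (z≡u , refl)) ]′
            (touches-end join t′)
        ... | no i≢i₀ = inj₁ λ σ (_ , only) →
            [ (λ eq → contradiction (only i eq) i≢i₀) , (λ eq → eq) ]′
              (two-ends σ i t t′ λ { refl → z∉ (x∈⁅x⁆ v) })
        cov : ∀ {y} → y ∈ A → y ∈ ⁅ v ⁆ ⊎ y ≡ u ⊎ y ∈ A - v - u
        cov {y} y∈A with y Fin.≟ v | y Fin.≟ u
        ... | yes refl | _       = inj₁ (x∈⁅x⁆ v)
        ... | no _     | yes eq  = inj₂ (inj₁ eq)
        ... | no y≢v   | no y≢u  = inj₂ (inj₂ (x∈p∧x≢y⇒x∈p-y (x∈p∧x≢y⇒x∈p-y y∈A y≢v) y≢u))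
      start : R U v ≤ Pr (Chain.state? C)
      start = ≤-trans (monotone 𝔼-linear λ σ → ind-mono (sinkBeyond? U v σ) (Chain.state? C (flip i₀ σ)) (pointwise σ))
                      (≤-reflexive (𝔼-flip i₀ (λ σ → ind (Chain.state? C σ))))
        where
        pointwise : ∀ σ → v ∈ sinks σ × sinks σ ⊆ U ∪ ⁅ v ⁆ → OnlyOut i₀ v (flip i₀ σ) × sinks (flip i₀ σ) ⊆ U ∪ ⁅ u ⁆
        pointwise σ (v∈ , Z⊆) = (tail-flip σ join eq , only) , within-flip U σ join eq Z⊆
          where
          eq : tail σ i₀ ≡ u
          eq = [ (λ e → contradiction e (∈sinks⁻ σ v∈ i₀)) , (λ e → e) ]′ (tail-end σ join)
          only : ∀ k → tail (flip i₀ σ) k ≡ v → k ≡ i₀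
          only k e with k Fin.≟ i₀
          ... | yes k≡ = k≡
          ... | no k≢ = contradiction (trans (sym (tail-flip-other σ k≢)) e) (∈sinks⁻ σ v∈ k)

  ∑-δ : ∀ {n} (u : Fin n) c → ∑ (λ a → ind (a Fin.≟ u) * c) ≡ c
  ∑-δ u c = trans (∑-single u λ a a≢u → trans (cong (_* c) (ind-no (a Fin.≟ u) a≢u)) (*-zeroˡ c))
                  (trans (cong (_* c) (ind-yes (u Fin.≟ u) refl)) (*-identityˡ c))

  -- Peeling leaves and the estimate on the core.

  module Peeling {n m : ℕ} (E : Fin m → Fin n × Fin n) (simple : SimpleGraph n m E) where
    open Sinks E
    open Popping E
    open Flipping E simple

    Inside : Subset n → Fin m → Fin n → Set
    Inside A i a = ∃ λ b → b ∈ A × Joins i a b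

    inside? : ∀ A i a → Dec (Inside A i a)
    inside? A i a = Fin.any? λ b → (b ∈? A) ×-dec joins? i a b

    degree : Subset n → Fin n → ℚ
    degree A a = ∑ λ i → ind (inside? A i a)

    0≤degree : ∀ A a → 0ℚ ≤ degree A a
    0≤degree A a = nonneg ∑-linear λ i → 0≤ind (inside? A i a)

    -- Only the degrees refer to the subgraph induced on `A`. The probabilities remain those of the
    -- whole graph, so peeling a vertex does not change the probability space.
    weight : Subset n → Subset n → ℚ
    weight U A = ∑ λ a → ind (a ∈? A) * (degree A a * R U a)

    0≤R : ∀ U a → 0ℚ ≤ R U a
    0≤R U a = 0≤Pr (sinkBeyond? U a)

    0≤Q : ∀ U → 0ℚ ≤ Q U
    0≤Q U = 0≤Pr (within? U)

    -- R U a ≤ (k - 1) Q U and weight U A ≤ k (k - 1) Q U, with Q U moved to the left to avoid subtraction.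
    BoundsFor : Subset n → Subset n → ℕ → Set
    BoundsFor U A k = (∀ {a} → a ∈ A → R U a + Q U ≤ ℕ→ℚ k * Q U)
                    × weight U A + ℕ→ℚ k * Q U ≤ ℕ→ℚ k * (ℕ→ℚ k * Q U)

    Bounds : Subset n → Subset n → Set
    Bounds U A = BoundsFor U A ∣ A ∣

    onlyOut-sum : ∀ U a → ∑ (λ i → Pr (onlyOutWithin? U i a)) ≤ Q U
    onlyOut-sum U a = subst (_≤ Q U) (∑-swap 𝔼-linear λ i σ → ind (onlyOutWithin? U i a σ))
        (monotone 𝔼-linear pointwise)
      where
      pointwise : ∀ σ → ∑ (λ i → ind (onlyOutWithin? U i a σ)) ≤ ind (within? U σ)
      pointwise σ = begin
        ∑ (λ i → ind (onlyOutWithin? U i a σ))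
          ≡⟨ ext ∑-linear (λ i → trans (sym (ind-× (onlyOut? i a σ) (within? U σ))) (*-comm (ind (onlyOut? i a σ)) _)) ⟩
        ∑ (λ i → ind (within? U σ) * ind (onlyOut? i a σ))
          ≡⟨ homogeneous ∑-linear (ind (within? U σ)) (λ i → ind (onlyOut? i a σ)) ⟩
        ind (within? U σ) * ∑ (λ i → ind (onlyOut? i a σ))
          ≤⟨ *-monoʳ (0≤ind (within? U σ)) (∑-atMostOne (λ i → onlyOut? i a σ) λ {i} {j} (out , _) (_ , only) → only i
              out) ⟩
        ind (within? U σ) * 1ℚ ≡⟨ *-identityʳ (ind (within? U σ)) ⟩
        ind (within? U σ) ∎
        where open ≤-Reasoning

    -- Degrees disappear because `R U a` is charged once for each inner edge at `a`, each time to a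
    -- different one of the disjoint events in `onlyOut-sum`. Thus every vertex contributes at most
    -- `(∣ A ∣ - 1) * Q U`, and there are `∣ A ∣` of them.
    core-bounds : ∀ U A {c} → c ∈ A → ExitsIn A → (∀ {a} → a ∈ A → ∃ λ i → Inside A i a) → Bounds U A
    core-bounds U A {c} c∈A exits linked = subst (BoundsFor U A) (sym (size-remove c∈A)) (single , total)
      where
      open ≤-Reasoning
      b = ∣ A - c ∣
      q = Q U
      bound : ∀ {i a} → a ∈ A → Inside A i a → R U a ≤ ℕ→ℚ b * Pr (onlyOutWithin? U i a)
      bound a∈A (u , u∈A , join) = R-bound U A exits a∈A u∈A join b (size-remove c∈A)
      single : ∀ {a} → a ∈ A → R U a + q ≤ ℕ→ℚ (suc b) * q
      single {a} a∈A = let i , ins = linked a∈A in begin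
        R U a + q        ≤⟨ +-monoˡ-≤ q (≤-trans (bound a∈A ins)
            (*-monoʳ (0≤ℕ→ℚ b) (Pr-mono (onlyOutWithin? U i a) (within? U) λ σ → proj₂))) ⟩
        ℕ→ℚ b * q + q    ≡⟨ trans (+-comm (ℕ→ℚ b * q) q) (sym (suc-* b q)) ⟩
        ℕ→ℚ (suc b) * q  ∎
      local : ∀ {a} → a ∈ A → degree A a * R U a ≤ ℕ→ℚ b * q
      local {a} a∈A = begin
        degree A a * R U a ≡⟨ trans (*-comm (degree A a) (R U a))
            (sym (homogeneous (∑-linear {m}) (R U a) (λ i → ind (inside? A i a)))) ⟩
        ∑ (λ i → R U a * ind (inside? A i a)) ≤⟨ monotone ∑-linear edge ⟩
        ∑ (λ i → ℕ→ℚ b * Pr (onlyOutWithin? U i a)) ≡⟨ homogeneous (∑-linear {m}) (ℕ→ℚ b)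
            (λ i → Pr (onlyOutWithin? U i a)) ⟩
        ℕ→ℚ b * ∑ (λ i → Pr (onlyOutWithin? U i a)) ≤⟨ *-monoʳ (0≤ℕ→ℚ b) (onlyOut-sum U a) ⟩
        ℕ→ℚ b * q ∎
        where
        edge : ∀ i → R U a * ind (inside? A i a) ≤ ℕ→ℚ b * Pr (onlyOutWithin? U i a)
        edge i = cases (inside? A i a)
          where
          cases : (d : Dec (Inside A i a)) → R U a * ind d ≤ ℕ→ℚ b * Pr (onlyOutWithin? U i a)
          cases (yes ins) = ≤-trans (≤-reflexive (*-identityʳ (R U a))) (bound a∈A ins)
          cases (no _)    = ≤-trans (≤-reflexive (*-zeroʳ (R U a))) (0≤* (0≤ℕ→ℚ b) (0≤Pr (onlyOutWithin? U i a)))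
      term : ∀ a → ind (a ∈? A) * (degree A a * R U a) ≤ ℕ→ℚ b * q * ind (a ∈? A)
      term a = cases (a ∈? A)
        where
        cases : (d : Dec (a ∈ A)) → ind d * (degree A a * R U a) ≤ ℕ→ℚ b * q * ind d
        cases (yes a∈A) = ≤-trans (≤-reflexive (*-identityˡ (degree A a * R U a)))
            (≤-trans (local a∈A) (≤-reflexive (sym (*-identityʳ (ℕ→ℚ b * q)))))
        cases (no _)    = ≤-reflexive (trans (*-zeroˡ (degree A a * R U a)) (sym (*-zeroʳ (ℕ→ℚ b * q))))
      s = ℕ→ℚ (suc b)
      total : weight U A + s * q ≤ s * (s * q)
      total = begin
        weight U A + s * q ≤⟨ +-monoˡ-≤ (s * q) (monotone ∑-linear term) ⟩
        ∑ (λ a → ℕ→ℚ b * q * ind (a ∈? A)) + s * q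
          ≡⟨ cong (_+ s * q) (trans (homogeneous ∑-linear (ℕ→ℚ b * q) (λ a → ind (a ∈? A)))
              (cong (ℕ→ℚ b * q *_) (trans (∑-size A) (cong ℕ→ℚ (size-remove c∈A))))) ⟩
        ℕ→ℚ b * q * s + s * q ≡⟨ solve 3 (λ b q s → b :* q :* s :+ s :* q := s :* (q :+ b :* q)) refl (ℕ→ℚ b) q s ⟩
        s * (q + ℕ→ℚ b * q)   ≡⟨ cong (s *_) (sym (suc-* b q)) ⟩
        s * (s * q) ∎

    record Leaf (A : Subset n) (u : Fin n) : Set where
      constructor leaf
      field
        {edge}   : Fin m
        {parent} : Fin n
        parent∈A : parent ∈ A
        join     : Joins edge u parent
        only     : ∀ j → Inside A j u → j ≡ edge

    -- Passing from `b` to `b + 1` vertices raises the allowance `b * (b - 1)` by `2 * b`. The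
    -- peeled leaf and its parent lose one degree each, which costs `R U u + R U v`, at most
    -- `b * Q U + (b - 1) * Q U`.
    leaf-bounds : ∀ U A {u} → u ∈ A → Leaf A u → Bounds U (A - u) → Bounds U A
    leaf-bounds U A {u} u∈A (leaf {i} {v} v∈A join only) (single′ , total′) =
      subst (BoundsFor U A) (sym (size-remove u∈A)) (single , total)
      where
      open ≤-Reasoning
      A′ = A - u
      b  = ∣ A′ ∣
      q  = Q U
      v∈A′ : v ∈ A′
      v∈A′ = x∈p∧x≢y⇒x∈p-y v∈A (no-loop join ∘ sym)
      Ru≤ : R U u ≤ ℕ→ℚ b * q
      Ru≤ = ≤-trans (R-neighbour U join) (≤-trans (≤-reflexive (+-comm q (R U v))) (single′ v∈A′))
      single : ∀ {a} → a ∈ A → R U a + q ≤ ℕ→ℚ (suc b) * q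
      single {a} a∈A = cases (a Fin.≟ u)
        where
        cases : Dec (a ≡ u) → R U a + q ≤ ℕ→ℚ (suc b) * q
        cases (yes refl) = ≤-trans (+-monoˡ-≤ q Ru≤) (≤-reflexive (trans (+-comm (ℕ→ℚ b * q) q) (sym (suc-* b q))))
        cases (no a≢u)   = ≤-trans (single′ (x∈p∧x≢y⇒x∈p-y a∈A a≢u))
                               (≤-trans (p≤q+p (0≤Q U)) (≤-reflexive (sym (suc-* b q))))
      degree-leaf : degree A u ≤ 1ℚ
      degree-leaf = ∑-atMostOne (λ j → inside? A j u) λ p p′ → trans (only _ p) (sym (only _ p′))
      degree-other : ∀ {a} → a ∈ A → a ≢ u → degree A a ≤ degree A′ a + ind (a Fin.≟ v)
      degree-other {a} a∈A a≢u = begin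
        degree A a ≤⟨ monotone ∑-linear (λ j → ind-⊎ (inside? A j a) (inside? A′ j a) (lost? j) (split j)) ⟩
        ∑ (λ j → ind (inside? A′ j a) + ind (lost? j)) ≡⟨ additive (∑-linear {m}) (λ j → ind (inside? A′ j a))
            (λ j → ind (lost? j)) ⟩
        degree A′ a + ∑ (λ j → ind (lost? j)) ≡⟨ cong (degree A′ a +_)
            (trans (ext ∑-linear λ j → sym (ind-× (j Fin.≟ i) (a Fin.≟ v))) (∑-δ i (ind (a Fin.≟ v)))) ⟩
        degree A′ a + ind (a Fin.≟ v) ∎
        where
        lost? : ∀ j → Dec (j ≡ i × a ≡ v)
        lost? j = (j Fin.≟ i) ×-dec (a Fin.≟ v)
        split : ∀ j → Inside A j a → Inside A′ j a ⊎ (j ≡ i × a ≡ v)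
        split j (w , w∈A , p) = cases (w Fin.≟ u)
          where
          cases : Dec (w ≡ u) → Inside A′ j a ⊎ (j ≡ i × a ≡ v)
          cases (no w≢u)   = inj₁ (w , x∈p∧x≢y⇒x∈p-y w∈A w≢u , p)
          cases (yes refl) = let j≡i = only j (a , a∈A , Joins-sym p) in
            inj₂ (j≡i , other-end (subst (λ j → Joins j u a) j≡i (Joins-sym p)) join)
      term : ∀ a → ind (a ∈? A) * (degree A a * R U a)
                 ≤ ind (a ∈? A′) * (degree A′ a * R U a) + (ind (a Fin.≟ u) * R U u + ind (a Fin.≟ v) * R U v)
      term a = cases (a ∈? A) (a Fin.≟ u) (a Fin.≟ v)
        where
        rest = ind (a ∈? A′) * (degree A′ a * R U a)
        0≤rest : 0ℚ ≤ rest
        0≤rest = 0≤* (0≤ind (a ∈? A′)) (0≤* (0≤degree A′ a) (0≤R U a))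
        cases : (d : Dec (a ∈ A)) (d′ : Dec (a ≡ u)) (d″ : Dec (a ≡ v)) →
                ind d * (degree A a * R U a) ≤ rest + (ind d′ * R U u + ind d″ * R U v)
        cases (no _) d′ d″ = subst (_≤ rest + (ind d′ * R U u + ind d″ * R U v)) (sym (*-zeroˡ (degree A a * R U a)))
          (0≤+ 0≤rest (0≤+ (0≤* (0≤ind d′) (0≤R U u)) (0≤* (0≤ind d″) (0≤R U v))))
        cases (yes _) (yes refl) d″ = begin
          1ℚ * (degree A a * R U a) ≤⟨ *-monoʳ 0≤1 (*-monoˡ (0≤R U u) degree-leaf) ⟩
          1ℚ * (1ℚ * R U u)         ≡⟨ *-identityˡ (1ℚ * R U u) ⟩
          1ℚ * R U u                ≤⟨ p≤p+q (0≤* (0≤ind d″) (0≤R U v)) ⟩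
          1ℚ * R U u + ind d″ * R U v ≤⟨ p≤q+p 0≤rest ⟩
          rest + (1ℚ * R U u + ind d″ * R U v) ∎
        cases (yes a∈A) (no a≢u) d″ = begin
          1ℚ * (degree A a * R U a) ≡⟨ *-identityˡ (degree A a * R U a) ⟩
          degree A a * R U a        ≤⟨ *-monoˡ (0≤R U a) (degree-other a∈A a≢u) ⟩
          (degree A′ a + ind (a Fin.≟ v)) * R U a ≡⟨ *-distribʳ-+ (R U a) (degree A′ a) (ind (a Fin.≟ v)) ⟩
          degree A′ a * R U a + ind (a Fin.≟ v) * R U a
            ≡⟨ cong₂ _+_ (trans (sym (*-identityˡ (degree A′ a * R U a)))
                (cong (_* (degree A′ a * R U a)) (sym (ind-yes (a ∈? A′) (x∈p∧x≢y⇒x∈p-y a∈A a≢u)))))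
                         (trans (relabel d″) (sym (trans (cong (_+ ind d″ * R U v) (*-zeroˡ (R U u)))
                             (+-identityˡ (ind d″ * R U v))))) ⟩
          rest + (0ℚ * R U u + ind d″ * R U v) ∎
          where
          relabel : (d : Dec (a ≡ v)) → ind (a Fin.≟ v) * R U a ≡ ind d * R U v
          relabel (yes refl) = cong (_* R U a) (ind-yes (a Fin.≟ a) refl)
          relabel (no a≢v)   = trans (cong (_* R U a) (ind-no (a Fin.≟ v) a≢v))
              (trans (*-zeroˡ (R U a)) (sym (*-zeroˡ (R U v))))
      weight≤ : weight U A ≤ weight U A′ + (R U u + R U v)
      weight≤ = begin
        weight U A ≤⟨ monotone ∑-linear term ⟩
        ∑ (λ a → ind (a ∈? A′) * (degree A′ a * R U a) + (ind (a Fin.≟ u) * R U u + ind (a Fin.≟ v) * R U v))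
          ≡⟨ trans (additive (∑-linear {n}) (λ a → ind (a ∈? A′) * (degree A′ a * R U a)) _)
               (cong (weight U A′ +_) (trans (additive (∑-linear {n}) (λ a → ind (a Fin.≟ u) * R U u) _)
                   (cong₂ _+_ (∑-δ u (R U u)) (∑-δ v (R U v))))) ⟩
        weight U A′ + (R U u + R U v) ∎
      s = ℕ→ℚ (suc b)
      β = ℕ→ℚ b
      total : weight U A + s * q ≤ s * (s * q)
      total = begin
        weight U A + s * q ≤⟨ +-monoˡ-≤ (s * q) weight≤ ⟩
        weight U A′ + (R U u + R U v) + s * q ≡⟨ cong (weight U A′ + (R U u + R U v) +_) (suc-* b q) ⟩
        weight U A′ + (R U u + R U v) + (q + β * q)
          ≡⟨ solve 5 (λ w x y q p → w :+ (x :+ y) :+ (q :+ p) := (w :+ p) :+ (x :+ (y :+ q))) refl (weight U A′)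
              (R U u) (R U v) q (β * q) ⟩
        weight U A′ + β * q + (R U u + (R U v + q)) ≤⟨ +-mono-≤ total′ (+-mono-≤ Ru≤ (single′ v∈A′)) ⟩
        -- The slack of one `q` completes the square of `β + 1`.
        β * (β * q) + (β * q + β * q)   ≤⟨ p≤p+q (0≤Q U) ⟩
        β * (β * q) + (β * q + β * q) + q
          ≡⟨ solve 2 (λ β q → β :* (β :* q) :+ (β :* q :+ β :* q) :+ q := q :+ β :* q :+ β :* (q :+ β :* q)) refl β q ⟩
        q + β * q + β * (q + β * q)     ≡⟨ sym (trans (suc-* b (s * q))
            (cong₂ (λ x y → x + β * y) (suc-* b q) (suc-* b q))) ⟩
        s * (s * q) ∎

    -- The goal `c` will be a cycle vertex, which is never peeled; walks to it record that what is
    -- left stays connected.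
    data WalkIn (A : Subset n) (c : Fin n) : Fin n → Set where
      stop : WalkIn A c c
      go   : ∀ {i a b} → b ∈ A → Joins i a b → WalkIn A c b → WalkIn A c a

    -- A walk that enters a leaf has to go back along the same edge, so this detour can be cut out.
    avoid-leaf : ∀ {A u c} → Leaf A u → c ≢ u → ∀ {a} → a ∈ A → a ≢ u → WalkIn A c a → WalkIn (A - u) c a
    avoid-leaf lf c≢u a∈A a≢u stop = stop
    avoid-leaf {u = u} lf c≢u a∈A a≢u (go {i} {a} {b} b∈A join w) with b Fin.≟ u
    ... | no b≢u = go (x∈p∧x≢y⇒x∈p-y b∈A b≢u) join (avoid-leaf lf c≢u b∈A b≢u w)
    avoid-leaf lf c≢u a∈A a≢u (go b∈A join stop) | yes refl = contradiction refl c≢u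
    avoid-leaf lf c≢u a∈A a≢u (go {i} {a} {b} b∈A join (go {j} {b = a′} a′∈A join′ w)) | yes refl
      with Leaf.only lf i (a , a∈A , Joins-sym join) | Leaf.only lf j (a′ , a′∈A , join′)
    ... | refl | refl with other-end (Joins-sym join) join′
    ... | refl = avoid-leaf lf c≢u a∈A a≢u w

    leaf? : ∀ A → Dec (∃ λ u → u ∈ A × ∃ λ i → Inside A i u × (∀ j → Inside A j u → j ≡ i))
    leaf? A = Fin.any? (λ u → (u ∈? A) ×-dec Fin.any? (λ i → inside? A i u ×-dec Fin.all?
        (λ j → inside? A j u →-dec (j Fin.≟ i))))

    -- All that peeling needs to know about a cycle: while `K` is contained in the remaining set, no
    -- vertex of `K` is a leaf.
    TwoEdges : (Fin n → Set) → Set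
    TwoEdges K = ∀ {z} → K z → ∃ λ i → ∃ λ j → i ≢ j × (∃ λ w → K w × Joins i z w) × (∃ λ w → K w × Joins j z w)

    module _ (U : Subset n) (K : Fin n → Set) (K-edges : TwoEdges K) {c} (Kc : K c) where

      -- When no leaf is left, the core hypotheses hold: the walk to `c`, or at `c` itself the
      -- cycle, provides an inner edge at each vertex, and a vertex with no second inner edge would
      -- be a leaf.
      peel : ∀ k A → ∣ A ∣ ℕ.≤ k → (∀ {z} → K z → z ∈ A) → (∀ {a} → a ∈ A → WalkIn A c a) → Bounds U A
      peel zero A small K⊆A walks = contradiction (ℕ.≤-trans (ℕ.≤-reflexive (sym (size-remove (K⊆A Kc)))) small) λ ()
      peel (suc k) A small K⊆A walks with leaf? A
      ... | yes (u , u∈A , i , (v , v∈A , join) , only) = leaf-bounds U A u∈A lf (peel k (A - u)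
              (ℕ.≤-pred (ℕ.≤-trans (ℕ.≤-reflexive (sym (size-remove u∈A))) small))
              (λ Kz → x∈p∧x≢y⇒x∈p-y (K⊆A Kz) (K≢u Kz))
              (λ {a} a∈ → avoid-leaf lf (K≢u Kc) (p─q⊆p A ⁅ u ⁆ a∈) (λ { refl → ∉p-x A u a∈ })
                  (walks (p─q⊆p A ⁅ u ⁆ a∈))))
        where
        lf : Leaf A u
        lf = leaf v∈A join only
        K≢u : ∀ {z} → K z → z ≢ u
        K≢u Kz refl with K-edges Kz
        ... | i , j , i≢j , (w , Kw , p) , (w′ , Kw′ , p′) = i≢j
            (trans (only i (w , K⊆A Kw , p)) (sym (only j (w′ , K⊆A Kw′ , p′))))
      ... | no ¬leaf = core-bounds U A (K⊆A Kc) exits linked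
        where
        linked : ∀ {a} → a ∈ A → ∃ λ i → Inside A i a
        linked a∈A with walks a∈A
        ... | go {i} {b = b} b∈A join _ = i , b , b∈A , join
        ... | stop with K-edges Kc
        ... | i , _ , _ , (w , Kw , p) , _ = i , w , K⊆A Kw , p
        exits : ExitsIn A
        exits {a} a∈A i with linked a∈A
        ... | i₁ , ins@(b , b∈A , join) with i₁ Fin.≟ i
        ... | no i₁≢i = i₁ , i₁≢i , b , b∈A , join
        ... | yes refl with Fin.any? (λ j → inside? A j a ×-dec ¬? (j Fin.≟ i₁))
        ... | yes (j , (w , w∈A , join′) , j≢i) = j , j≢i , w , w∈A , join′
        ... | no ¬other = contradiction (a , a∈A , i₁ , ins , λ j ins′ → decidable-stable (j Fin.≟ i₁) λ j≢ → ¬other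
            (j , ins′ , j≢)) ¬leaf

  count-∑ : ∀ {k} (M : Vec Bool k) → ℕ→ℚ (count M) ≡ ∑ (λ i → ind (lookup M i Bool.≟ true))
  count-∑ []          = refl
  count-∑ (true ∷ M)  = trans (ℕ→ℚ-suc (count M)) (cong (1ℚ +_) (count-∑ M))
  count-∑ (false ∷ M) = trans (count-∑ M) (sym (+-identityˡ (∑ (λ i → ind (lookup M i Bool.≟ true)))))

  -- Cycles survive the peeling.

  module Cycles {n m : ℕ} (E : Fin m → Fin n × Fin n) (simple : SimpleGraph n m E) where
    open Flipping E simple
    open Peeling E simple

    OnCycle : HasCycle E → Fin n → Set
    OnCycle (k , c , _) z = ∃ λ t → c t ≡ z

    -- On a cycle of length at least 3 the predecessor and successor of a position differ, hence so
    -- do the vertices there, by injectivity, and the edges leading to them.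
    cycle-edges : ∀ C → TwoEdges (OnCycle C)
    cycle-edges (k , c , inj , edge , close) {z} (t , refl) = from-neighbours (neighbours t)
      where
      Neighbours : Fin (3 ℕ.+ k) → Set
      Neighbours t = ∃ λ s → ∃ λ s′ → s ≢ s′ × Adj E (c t) (c s) × Adj E (c t) (c s′)

      back : ∀ {u v} → Adj E u v → Adj E v u
      back (i , join) = i , Joins-sym join

      neighbours : ∀ t → Neighbours t
      neighbours t with view t
      ... | ‵fromℕ = inject₁ (fromℕ (1 ℕ.+ k)) , zero , (λ ()) , back (edge (fromℕ (1 ℕ.+ k))) , close
      ... | ‵inject₁ zero = suc zero , fromℕ (2 ℕ.+ k) , (λ ()) , edge zero , back close
      ... | ‵inject₁ (suc s) = suc (suc s) , inject₁ (inject₁ s) , apart , edge (suc s) , back (edge (inject₁ s))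
        where
        apart : suc (suc s) ≢ inject₁ (inject₁ s)
        apart e = ℕ.m≢1+n+m (toℕ s) {1} (sym (trans (cong toℕ e)
            (trans (Fin.toℕ-inject₁ (inject₁ s)) (Fin.toℕ-inject₁ s))))

      from-neighbours : Neighbours t → _
      from-neighbours (s , s′ , s≢s′ , (i , p) , (j , p′)) =
        i , j , (λ { refl → s≢s′ (inj (other-end p p′)) }) , (c s , (s , refl) , p) , (c s′ , (s′ , refl) , p′)

    walk-in : ∀ {a c} → Walk E a c → WalkIn ⊤ c a
    walk-in here = stop
    walk-in (step (i , join) w) = go ∈⊤ join (walk-in w)

    cycle-bounds : Connected E → HasCycle E → ∀ U → Bounds U ⊤
    cycle-bounds connected C@(_ , c , _) U =
      peel U (OnCycle C) (cycle-edges C) {c zero} (zero , refl) n ⊤ (∣p∣≤n ⊤) (λ _ → ∈⊤)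
          (λ {a} _ → walk-in (connected a (c zero)))

  -- From pops of vertices to draws of edges.

  module Draws {n m : ℕ} (E : Fin m → Fin n × Fin n) (simple : SimpleGraph n m E) where
    open Sinks E
    open Popping E
    open Flipping E simple
    open Peeling E simple

    touches⇒inside : ∀ {i z} → Touches i z → Inside ⊤ i z
    touches⇒inside {i} (inj₁ refl) = proj₂ (E i) , ∈⊤ , inj₁ refl
    touches⇒inside {i} (inj₂ refl) = proj₁ (E i) , ∈⊤ , inj₂ refl

    -- Every redrawn edge is charged to a sink that it touches, and a sink receives at most its
    -- degree in charges.
    count≤ : ∀ σ → ℕ→ℚ (count (resampleMask E σ)) ≤ ∑ (λ a → degree ⊤ a * ind (a ∈? sinks σ))
    count≤ σ = begin
      ℕ→ℚ (count (resampleMask E σ)) ≡⟨ trans (cong (ℕ→ℚ ∘ count) (resampleMask≡mask σ)) (count-∑ (mask (sinks σ))) ⟩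
      ∑ (λ i → ind (lookup (mask (sinks σ)) i Bool.≟ true)) ≤⟨ monotone ∑-linear edge ⟩
      ∑ (λ i → ∑ (λ a → summand i a)) ≡⟨ ∑-swap ∑-linear (λ a i → summand i a) ⟩
      ∑ (λ a → ∑ (λ i → summand i a))
        ≡⟨ ext ∑-linear (λ a → trans (homogeneous ∑-linear (ind (a ∈? sinks σ)) (λ i → ind (inside? ⊤ i a)))
            (*-comm (ind (a ∈? sinks σ)) (degree ⊤ a))) ⟩
      ∑ (λ a → degree ⊤ a * ind (a ∈? sinks σ)) ∎
      where
      open ≤-Reasoning
      summand : Fin m → Fin n → ℚ
      summand i a = ind (a ∈? sinks σ) * ind (inside? ⊤ i a)
      edge : ∀ i → ind (lookup (mask (sinks σ)) i Bool.≟ true) ≤ ∑ (summand i)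
      edge i = ind-≤ (lookup (mask (sinks σ)) i Bool.≟ true) (nonneg ∑-linear 0≤summand) λ e →
        let z , z∈ , t = mask-touches⁻ {sinks σ} e
        in ≤-trans (≤-reflexive (sym (cong₂ _*_ (ind-yes (z ∈? sinks σ) z∈)
            (ind-yes (inside? ⊤ i z) (touches⇒inside t)))))
                   (term≤∑ 0≤summand z)
        where
        0≤summand : ∀ a → 0ℚ ≤ summand i a
        0≤summand a = 0≤* (0≤ind (a ∈? sinks σ)) (0≤ind (inside? ⊤ i a))

    furtherDraws≤ : ∀ r σ → expectedFurtherDraws E r σ ≤ ∑ (λ a → degree ⊤ a * visits a r σ)
    furtherDraws≤ zero σ = nonneg ∑-linear λ a → 0≤* (0≤degree ⊤ a) ≤-refl
    furtherDraws≤ (suc r) σ = round (hasSink E σ)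
      where
      open ≤-Reasoning
      L = resampleAvg (resampleMask E σ) σ
      linear = avg-linear (resampleMask E σ) σ
      round : ∀ b → (if b then ℕ→ℚ (count (resampleMask E σ)) + L (expectedFurtherDraws E r) else 0ℚ)
                  ≤ ∑ (λ a → degree ⊤ a * (if b then ind (a ∈? sinks σ) + L (visits a r) else 0ℚ))
      round false = nonneg ∑-linear λ a → 0≤* (0≤degree ⊤ a) ≤-refl
      round true = begin
        ℕ→ℚ (count (resampleMask E σ)) + L (expectedFurtherDraws E r)
          ≤⟨ +-mono-≤ (count≤ σ) (monotone linear (furtherDraws≤ r)) ⟩
        ∑ (λ a → degree ⊤ a * ind (a ∈? sinks σ)) + L (λ τ → ∑ (λ a → degree ⊤ a * visits a r τ))
          ≡⟨ cong (∑ (λ a → degree ⊤ a * ind (a ∈? sinks σ)) +_)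
               (trans (∑-swap linear (λ a τ → degree ⊤ a * visits a r τ))
                   (ext ∑-linear λ a → homogeneous linear (degree ⊤ a) (visits a r))) ⟩
        ∑ (λ a → degree ⊤ a * ind (a ∈? sinks σ)) + ∑ (λ a → degree ⊤ a * L (visits a r))
          ≡⟨ sym (additive ∑-linear (λ a → degree ⊤ a * ind (a ∈? sinks σ)) _) ⟩
        ∑ (λ a → degree ⊤ a * ind (a ∈? sinks σ) + degree ⊤ a * L (visits a r))
          ≡⟨ ext ∑-linear (λ a → sym (*-distribˡ-+ (degree ⊤ a) (ind (a ∈? sinks σ)) (L (visits a r)))) ⟩
        ∑ (λ a → degree ⊤ a * (ind (a ∈? sinks σ) + L (visits a r))) ∎

    module _ (bounds : ∀ U → Bounds U ⊤) where

      private
        N = ℕ→ℚ ∣ ⊤ {n} ∣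

      Q-insert≤ : ∀ U v → Q (U ∪ ⁅ v ⁆) ≤ N * Q U
      Q-insert≤ U v = ≤-trans (Q-insert U v) (≤-trans (≤-reflexive (+-comm (Q U) (R U v))) (proj₁ (bounds U) ∈⊤))

      insertAll : List (Fin n) → Subset n
      insertAll = foldr (λ v U → U ∪ ⁅ v ⁆) ⊥

      ∈-insertAll : ∀ {z xs} → z ∈ₗ xs → z ∈ insertAll xs
      ∈-insertAll {z} (here refl) = x∈p∪q⁺ (inj₂ (x∈⁅x⁆ z))
      ∈-insertAll (there z∈) = x∈p∪q⁺ (inj₁ (∈-insertAll z∈))

      -- A vanishing probability of sink-freeness would propagate, one vertex at a time, to the certain event.
      0<Q⊥ : 0ℚ < Q ⊥
      0<Q⊥ = ≰⇒> λ Q⊥≤0 → <-irrefl refl (<-≤-trans (positive⁻¹ 1ℚ) (≤-trans all (propagate Q⊥≤0 (allFin n))))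
        where
        propagate : Q ⊥ ≤ 0ℚ → ∀ xs → Q (insertAll xs) ≤ 0ℚ
        propagate Q⊥≤0 []       = Q⊥≤0
        propagate Q⊥≤0 (v ∷ xs) = ≤-trans (Q-insert≤ (insertAll xs) v)
          (≤-trans (*-monoʳ (0≤ℕ→ℚ ∣ ⊤ {n} ∣) (propagate Q⊥≤0 xs)) (≤-reflexive (*-zeroʳ N)))
        all : 1ℚ ≤ Q (insertAll (allFin n))
        all = ≤-trans (≤-reflexive (sym (avg-const (replicate m true) (replicate m false) 1ℚ)))
          (monotone 𝔼-linear λ σ → ≤-reflexive (sym (ind-yes (within? (insertAll (allFin n)) σ) λ _ → ∈-insertAll
              (∈-allFin _))))

      weighted : ∀ r → Q ⊥ * 𝔼 (expectedFurtherDraws E r) ≤ weight ⊥ ⊤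
      weighted r = begin
        Q ⊥ * 𝔼 (expectedFurtherDraws E r) ≤⟨ *-monoʳ (0≤Q ⊥) (monotone 𝔼-linear (furtherDraws≤ r)) ⟩
        Q ⊥ * 𝔼 (λ σ → ∑ (λ a → degree ⊤ a * visits a r σ))
          ≡⟨ cong (Q ⊥ *_) (trans (∑-swap 𝔼-linear (λ a σ → degree ⊤ a * visits a r σ))
              (ext ∑-linear λ a → homogeneous 𝔼-linear (degree ⊤ a) (visits a r))) ⟩
        Q ⊥ * ∑ (λ a → degree ⊤ a * 𝔼 (visits a r))   ≡⟨ sym
            (homogeneous (∑-linear {n}) (Q ⊥) (λ a → degree ⊤ a * 𝔼 (visits a r))) ⟩
        ∑ (λ a → Q ⊥ * (degree ⊤ a * 𝔼 (visits a r)))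
          ≡⟨ ext ∑-linear (λ a → solve 3 (λ q d e → q :* (d :* e) := d :* (q :* e)) refl (Q ⊥) (degree ⊤ a)
              (𝔼 (visits a r))) ⟩
        ∑ (λ a → degree ⊤ a * (Q ⊥ * 𝔼 (visits a r)))
          ≤⟨ monotone ∑-linear (λ a → *-monoʳ (0≤degree ⊤ a) (expectedVisits≤ 0<Q⊥ a r)) ⟩
        ∑ (λ a → degree ⊤ a * R ⊥ a)
          ≡⟨ ext ∑-linear (λ a → sym (trans (cong (_* (degree ⊤ a * R ⊥ a)) (ind-yes (a ∈? ⊤) ∈⊤))
              (*-identityˡ (degree ⊤ a * R ⊥ a)))) ⟩
        weight ⊥ ⊤ ∎
        where open ≤-Reasoning

  -- The final estimate.

  furtherDraws-bound : ∀ n m (E : Fin m → Fin n × Fin n) → SimpleGraph n m E → Connected E → HasCycle E → ∀ r →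
                       uniformAvg m (expectedFurtherDraws E r) ≤ ℕ→ℚ (n ℕ.* (n ℕ.∸ 1))
  furtherDraws-bound zero m E simple connected (_ , c , _) with c zero
  ... | ()
  furtherDraws-bound (suc n) m E simple connected cycle r = *-cancelˡ-≤-pos q {{positive (0<Q⊥ bounds)}}
      -- With `s = n + 1` vertices, adding `s * q` turns the claimed `s * n * q` into `s * s * q`,
      -- the subtraction-free form in which the weight bound is stated.
      (+-cancelʳ-≤ (s * q) (begin
    q * uniformAvg m (expectedFurtherDraws E r) + s * q ≤⟨ +-monoˡ-≤ (s * q) (weighted bounds r) ⟩
    weight ⊥ ⊤ + s * q        ≤⟨ subst (λ k → weight ⊥ ⊤ + ℕ→ℚ k * q ≤ ℕ→ℚ k * (ℕ→ℚ k * q)) (∣⊤∣≡n (suc n))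
        (proj₂ (bounds ⊥)) ⟩
    s * (s * q)               ≡⟨ cong (s *_) (suc-* n q) ⟩
    s * (q + ℕ→ℚ n * q)       ≡⟨ solve 3 (λ s q t → s :* (q :+ t :* q) := q :* (s :* t) :+ s :* q) refl s q (ℕ→ℚ n) ⟩
    q * (s * ℕ→ℚ n) + s * q   ≡⟨ cong (λ z → q * z + s * q) (sym (ℕ→ℚ-* (suc n) n)) ⟩
    q * ℕ→ℚ (suc n ℕ.* n) + s * q ∎))
    where
    open ≤-Reasoning
    open Popping E
    open Peeling E simple
    open Draws E simple
    bounds = Cycles.cycle-bounds E simple connected cycle
    q = Q ⊥
    s = ℕ→ℚ (suc n)

  expectedDraws-bound : (n m : ℕ) (E : Fin m → Fin n × Fin n) →
      SimpleGraph n m E → Connected E → ¬ IsTree E →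
      (r : ℕ) → expectedDrawsUpTo E r ≤ ℕ→ℚ (m ℕ.+ n ℕ.* (n ℕ.∸ 1))
  -- Not being a tree yields a cycle only up to double negation. The order on the rationals is
  -- decidable, so the inequality may be proved by contradiction, with a cycle at hand.
  expectedDraws-bound n m E simple connected ¬tree r = decidable-stable (_ ≤? _) λ ≰ → ¬tree
      (connected , λ cycle → ≰ (begin
    ℕ→ℚ m + uniformAvg m (expectedFurtherDraws E r) ≤⟨ +-monoʳ-≤ (ℕ→ℚ m)
        (furtherDraws-bound n m E simple connected cycle r) ⟩
    ℕ→ℚ m + ℕ→ℚ (n ℕ.* (n ℕ.∸ 1))                   ≡⟨ sym (ℕ→ℚ-+ m (n ℕ.* (n ℕ.∸ 1))) ⟩
    ℕ→ℚ (m ℕ.+ n ℕ.* (n ℕ.∸ 1))                     ∎))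
    where open ≤-Reasoning

open import Data.Nat using (ℕ; _*_; _∸_; _+_)
open import Data.Fin using (Fin)
open import Data.Product using (_×_)
open import Data.Rational using (_≤_)
open import Relation.Nullary using (¬_)

theorem5p4 : (n m : ℕ) (E : Fin m → Fin n × Fin n) →
    SimpleGraph n m E → Connected E → ¬ IsTree E →
    (r : ℕ) → expectedDrawsUpTo E r ≤ ℕ→ℚ (m + n * (n ∸ 1))
theorem5p4 = SinkPopping.expectedDraws-bound
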